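{- Let $r\ge 3$ be an integer, let $G$ be any $\{C_{1r},C^*\}$-free linear $r$-graph on $n$ vertices, and let $s$ denote the number of vertices of $G$ with degree at least $(r-1)^2+2$. Then $$|E(G)|\le \frac{r(r-2)(n-s)}{r-1}.$$
   Context: An $r$-graph $H=(V,E)$ consists of a (finite, nonempty) vertex set $V=V(H)$ and a collection $E=E(H)$ of $r$-element subsets of $V$, called edges. It is linear if any two distinct edges intersect in at most one vertex. The degree $d(v)$ of a vertex $v$ is the number of edges containing $v$. For linear $r$-graphs $F_1,F_2$, an $r$-graph $H$ is $\{F_1,F_2\}$-free if it contains no copy of $F_1$ and no copy of $F_2$ as a (not necessarily induced) subhypergraph. The $r$-crown $C_{1r}$ is the linear $r$-graph on $r^2$ vertices with $r+1$ edges obtained from $r$ pairwise disjoint edges by adding one edge that intersects each of them in exactly one vertex. $C^*$ is the linear $r$-graph on $r^2-r+3$ vertices with $r+1$ edges $e_1,\dots,e_r,e$ such that: the $r-2$ edges $e_1,\dots,e_{r-2}$ all contain a common vertex $v$ and are otherwise pairwise disjoint (for $r=3$ there is just one such edge $e_1$, with $v$ a vertex of it); the edges $e_{r-1}$ and $e_r$ are disjoint from each other and from each of $e_1,\dots,e_{r-2}$; and the edge $e$ does not contain $v$ and intersects each of $e_1,\dots,e_r$ in exactly one vertex. -}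

module Defs where

open import Data.Fin.Base using (Fin)
open import Data.Fin.Properties using (any?; _≟_)
open import Data.Fin.Subset using (Subset; ∣_∣; _∩_; Empty; ⁅_⁆; _∈_; _∉_)
open import Data.Fin.Subset.Properties using (_∈?_)
open import Data.List.Base using (List; _∷_; length; filter; allFin; tabulate)
import Data.List.Membership.Propositional as List
open import Data.List.Relation.Binary.Permutation.Propositional using (_↭_)
open import Data.List.Relation.Unary.All using (All)
open import Data.List.Relation.Unary.Unique.Propositional using (Unique)
open import Data.Nat.Base using (ℕ; _+_; _*_; _∸_; _≤_; NonZero; s≤s)
open import Data.Nat.Properties using (_≤?_)
import Data.Vec.Base as Vec
open import Function.Definitions using (Injective)
open import Relation.Binary.PropositionalEquality using (_≡_; _≢_)
open import Relation.Nullary.Decidable using (does; _×-dec_)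
open import Relation.Nullary.Negation using (¬_)

-- An r-graph with vertex set Fin n.  `Unique` makes the list of edges a set,
-- so its length is the number of edges.
record RGraph (r n : ℕ) : Set where
  field
    nonempty : NonZero n
    edges    : List (Subset n)
    unique   : Unique edges
    uniform  : All (λ e → ∣ e ∣ ≡ r) edges

open RGraph public

∣E_∣ : ∀ {r n} → RGraph r n → ℕ
∣E G ∣ = length (edges G)

Linear : ∀ {r n} → RGraph r n → Set
Linear G = ∀ {e f} → e List.∈ edges G → f List.∈ edges G → e ≢ f → ∣ e ∩ f ∣ ≤ 1

degree : ∀ {r n} → RGraph r n → Fin n → ℕ
degree G v = length (filter (v ∈?_) (edges G))

#degree≥ : ∀ {r n} → ℕ → RGraph r n → ℕ
#degree≥ {n = n} d G = length (filter (λ v → d ≤? degree G v) (allFin n))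

image : ∀ {m n} → (Fin m → Fin n) → Subset m → Subset n
image φ p = Vec.tabulate λ y → does (any? λ x → (x ∈? p) ×-dec (φ x ≟ y))

-- Not necessarily induced: only edges of F are required to be preserved.
record Copy {r m n} (F : RGraph r m) (H : RGraph r n) : Set where
  field
    embed     : Fin m → Fin n
    injective : Injective _≡_ _≡_ embed
    preserves : ∀ {e} → e List.∈ edges F → image embed e List.∈ edges H

Disjoint : ∀ {n} → Subset n → Subset n → Set
Disjoint p q = Empty (p ∩ q)

-- The r-crown and C* are specified up to isomorphism.  In both records the
-- field `edges-are`, together with `unique`, says that the r + 1 listed edges
-- are distinct and are all the edges of F.
record IsCrown {r} (F : RGraph r (r * r)) : Set where
  field
    linear    : Linear F
    spoke     : Fin r → Subset (r * r)
    base      : Subset (r * r)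
    edges-are : edges F ↭ base ∷ tabulate spoke
    disjoint  : ∀ {i j} → i ≢ j → Disjoint (spoke i) (spoke j)
    meets     : ∀ i → ∣ base ∩ spoke i ∣ ≡ 1

-- The petals are e₁, …, e_{r-2}; a and b are e_{r-1} and e_r; base is e.
-- Meant for r ≥ 3, where the subtractions are exact.
record IsC* {r} (F : RGraph r (r * r ∸ r + 3)) : Set where
  field
    linear        : Linear F
    v             : Fin (r * r ∸ r + 3)
    petal         : Fin (r ∸ 2) → Subset (r * r ∸ r + 3)
    a b base      : Subset (r * r ∸ r + 3)
    edges-are     : edges F ↭ base ∷ a ∷ b ∷ tabulate petal
    v∈petal       : ∀ i → v ∈ petal i
    petals-meet   : ∀ {i j} → i ≢ j → petal i ∩ petal j ≡ ⁅ v ⁆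
    a-b-disjoint  : Disjoint a b
    a-disjoint    : ∀ i → Disjoint a (petal i)
    b-disjoint    : ∀ i → Disjoint b (petal i)
    v∉base        : v ∉ base
    meets-petal   : ∀ i → ∣ base ∩ petal i ∣ ≡ 1
    meets-a       : ∣ base ∩ a ∣ ≡ 1
    meets-b       : ∣ base ∩ b ∣ ≡ 1

CrownFree : ∀ {r n} → RGraph r n → Set
CrownFree {r} G = ∀ (F : RGraph r (r * r)) → IsCrown F → ¬ Copy F G

C*Free : ∀ {r n} → RGraph r n → Set
C*Free {r} G = ∀ (F : RGraph r (r * r ∸ r + 3)) → IsC* F → ¬ Copy F G

r∸1-nonZero : ∀ {r} → 3 ≤ r → NonZero (r ∸ 1)
r∸1-nonZero (s≤s (s≤s _)) = _

{-# OPTIONS --safe #-}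
module Submission where

-- Every vertex of degree at most t = (r-1)² + 1 distributes a fixed total among its edges, and it suffices that
-- each edge collects enough.  Sort the vertices of an edge by degree, u₀, u₁, …  If deg uⱼ ≥ j(r-1) + 2 for all j,
-- then spokes at u₀, u₁, … can be chosen greedily and form a crown.  So for some j the vertices u₀, …, uⱼ all have
-- degree at most j(r-1) + 1, and for r ≥ 4 these alone make the edge collect enough under equal sharing.
--
-- For r = 3 equal sharing fails just for edges with degrees (4,5,5) and (5,5,5), so a vertex of degree 5 gives more
-- to those.  It can afford this for at most three of its five edges.  Indeed let xyz be such an edge with
-- deg y = deg z = 5.  Crown-freeness forces, for every further line xaw, lines yab, zac, ycw and zbw, and then a has
-- no edge besides its lines through x, y, z.  So the lines through y and a, and through y and w, are not of this kind.

open import Data.Bool.Base using (Bool; true; false)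
open import Data.Bool.Properties using () renaming (_≟_ to _≟ᵇ_)
open import Data.Empty using (⊥; ⊥-elim)
open import Data.Fin.Base using (Fin; zero; suc; combine; remQuot; cast; toℕ)
open import Data.Fin.Properties
  using (any?; _≟_; remQuot-combine; combine-remQuot; combine-injectiveˡ; combine-injectiveʳ; toℕ-injective;
         toℕ-cast; cast-involutive)
open import Data.Fin.Subset using (Subset; ∣_∣; _∩_; _-_; ⁅_⁆; _∈_; _∉_; _⊆_) renaming (⊤ to full)
open import Data.Fin.Subset.Properties
  using (_∈?_; ∈⊤; ⊆-antisym; x∈⁅x⁆; x∈⁅y⁆⇒x≡y; ∣⁅x⁆∣≡1; x∈p∩q⁺; x∈p∩q⁻; x∈p∧x≢y⇒x∈p-y; x∈p⇒∣p-x∣<∣p∣;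
         p─q⊆p; drop-there; ∩-idem; ∩-comm; Empty-unique; ∣⊥∣≡0)
open import Data.Integer.Base as ℤ using (+_; +≤+)
import Data.Integer.Properties as ℤ
open import Data.List.Base using (List; []; _∷_; _++_; length; filter; allFin; tabulate; lookup; map)
import Data.List.Membership.Propositional as List
open import Data.List.Membership.Propositional.Properties
  using (∈-filter⁺; ∈-filter⁻; ∈-allFin; ∈-tabulate⁺; ∈-tabulate⁻; ∈-lookup; ∈-map⁺; ∈-map⁻; ∈-++⁺ˡ; ∈-++⁺ʳ)
open import Data.List.Membership.Propositional.Properties.WithK using (unique∧set⇒bag)
open import Data.List.Properties
  using (length-tabulate; length-map; length-++; length-filter; filter-all; filter-none; filter-notAll; map-++)
open import Data.List.Relation.Binary.BagAndSetEquality using (∼bag⇒↭)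
open import Data.List.Relation.Binary.Permutation.Propositional using (_↭_; ↭-refl; ↭-sym; ↭⇒↭ₛ)
open import Data.List.Relation.Binary.Permutation.Propositional.Properties using (↭-length; map⁺; ∈-resp-↭)
open import Data.List.Relation.Binary.Permutation.Setoid.Properties using (Unique-resp-↭)
open import Data.List.Relation.Unary.All as All using (All; []; _∷_)
import Data.List.Relation.Unary.All.Properties as Allₚ
open import Data.List.Relation.Unary.AllPairs as AllPairs using (AllPairs; []; _∷_)
open import Data.List.Relation.Unary.Any as Any using (here; there; index)
open import Data.List.Relation.Unary.Any.Properties using (lookup-index)
open import Data.List.Relation.Unary.Sorted.TotalOrder.Properties using (Sorted⇒AllPairs)
open import Data.List.Relation.Unary.Unique.Propositional using (Unique)
import Data.List.Relation.Unary.Unique.Propositional.Properties as Unique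
import Data.List.Sort
open import Data.Nat.Base hiding (∣_-_∣)
open import Data.Nat.Divisibility using (m∣m*n; ∣-trans; m≤n⇒m!∣n!)
open import Data.Nat.DivMod using (m/n*n≤m; m/n*n≡m; /-monoʳ-≤)
open import Data.Nat.ListAction using (sum)
open import Data.Nat.ListAction.Properties using (sum-++; sum-↭)
open import Data.Nat.Properties hiding (_≟_)
open import Data.Nat.Tactic.RingSolver using (solve-∀)
open import Data.Product.Base using (∃; ∃₂; _×_; _,_; proj₁; proj₂; uncurry)
import Data.Rational.Base as ℚ
import Data.Rational.Properties as ℚ
import Data.Rational.Unnormalised.Base as ℚᵘ
import Data.Rational.Unnormalised.Properties as ℚᵘ
open import Data.Sum.Base using (_⊎_; inj₁; inj₂; [_,_]′)
open import Data.Unit.Base using (⊤; tt)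
open import Data.Vec.Base using ([]; _∷_; here; there)
open import Data.Vec.Properties using (lookup∘tabulate; []=⇒lookup; lookup⇒[]=) renaming (≡-dec to Vec-≡-dec)
open import Function.Base using (_∘_; id)
open import Function.Bundles using (mk⇔)
open import Function.Definitions using (Injective)
open import Relation.Binary.Bundles using (DecTotalOrder)
import Relation.Binary.Construct.On as On
open import Relation.Binary.Definitions using (Symmetric)
open import Relation.Binary.PropositionalEquality
open import Relation.Nullary.Decidable using (Dec; does; yes; no; ¬?; _×-dec_; dec-true; toSum)
open import Relation.Nullary.Negation using (¬_; contradiction)
open import Relation.Unary using (Decidable)

open import Defs

private
  variable
    A B : Set
    m n r : ℕ

-- Finite lists, subsets and images

lookup-AllPairs : ∀ {R : A → A → Set} → Symmetric R → ∀ {xs} → AllPairs R xs →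
                  ∀ {i j} → i ≢ j → R (lookup xs i) (lookup xs j)
lookup-AllPairs R-sym (_ ∷ _)   {zero}  {zero}  i≢j = contradiction refl i≢j
lookup-AllPairs R-sym (Rx ∷ _)  {zero}  {suc j} _   = All.lookup Rx (∈-lookup j)
lookup-AllPairs R-sym (Rx ∷ _)  {suc i} {zero}  _   = R-sym (All.lookup Rx (∈-lookup i))
lookup-AllPairs R-sym (_ ∷ Rxs) {suc i} {suc j} i≢j = lookup-AllPairs R-sym Rxs (i≢j ∘ cong suc)

lookup-injective : ∀ {xs : List A} → Unique xs → Injective _≡_ _≡_ (lookup xs)
lookup-injective xs! {i} {j} eq with i ≟ j
... | yes i≡j = i≡j
... | no  i≢j = contradiction eq (lookup-AllPairs (_∘ sym) xs! i≢j)

-- The function `f` is arbitrary, although only `id` is needed later, because the induction on `p`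
-- replaces `f` by `f ∘ suc`.
length-filter-tabulate : ∀ {P : A → Set} (P? : Decidable P) (f : Fin m → A) (p : Subset m) →
  (∀ i → P (f i) → i ∈ p) → (∀ i → i ∈ p → P (f i)) → length (filter P? (tabulate f)) ≡ ∣ p ∣
length-filter-tabulate P? f []      _    _    = refl
length-filter-tabulate P? f (s ∷ p) P⇒∈p ∈p⇒P
  with ih ← length-filter-tabulate P? (f ∘ suc) p (λ i → drop-there ∘ P⇒∈p (suc i)) (λ i → ∈p⇒P (suc i) ∘ there)
  with P? (f zero) | s
... | yes _  | true  = cong suc ih
... | no  _  | false = ih
... | yes Pz | false = contradiction (P⇒∈p zero Pz) λ ()
... | no ¬Pz | true  = contradiction (∈p⇒P zero here) ¬Pz

-- Edges are Boolean vectors, whereas ordering their vertices by degree, or naming the three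
-- vertices of a triple, calls for lists.
record _Enumerates_ (xs : List (Fin n)) (p : Subset n) : Set where
  field
    distinct : Unique xs
    to       : ∀ {x} → x List.∈ xs → x ∈ p
    from     : ∀ {x} → x ∈ p → x List.∈ xs

open _Enumerates_

elements : Subset n → List (Fin n)
elements {n} p = filter (_∈? p) (allFin n)

elements-enumerates : (p : Subset n) → elements p Enumerates p
elements-enumerates p = record
  { distinct = Unique.filter⁺ (_∈? p) (Unique.allFin⁺ _)
  ; to       = proj₂ ∘ ∈-filter⁻ (_∈? p) {xs = allFin _}
  ; from     = ∈-filter⁺ (_∈? p) (∈-allFin _)
  }

enumerations-↭ : ∀ {xs ys} {p : Subset n} → xs Enumerates p → ys Enumerates p → xs ↭ ys
enumerations-↭ ex ey =
  ∼bag⇒↭ (unique∧set⇒bag (distinct ex) (distinct ey) (mk⇔ (from ey ∘ to ex) (from ex ∘ to ey)))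

length-elements : (p : Subset n) → length (elements p) ≡ ∣ p ∣
length-elements p = length-filter-tabulate (_∈? p) id p (λ _ → id) (λ _ → id)

length-enumeration : ∀ {xs} {p : Subset n} → xs Enumerates p → length xs ≡ ∣ p ∣
length-enumeration {p = p} ex = trans (↭-length (enumerations-↭ ex (elements-enumerates p))) (length-elements p)

∈-image⁺ : ∀ (φ : Fin m → Fin n) {p x} → x ∈ p → φ x ∈ image φ p
∈-image⁺ φ {p} {x} x∈p = lookup⇒[]= (φ x) (image φ p)
  (trans (lookup∘tabulate _ (φ x)) (dec-true (any? λ x′ → (x′ ∈? p) ×-dec (φ x′ ≟ φ x)) (x , x∈p , refl)))

∈-image⁻ : ∀ (φ : Fin m → Fin n) {p y} → y ∈ image φ p → ∃ λ x → x ∈ p × φ x ≡ y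
∈-image⁻ φ {p} {y} y∈
  with any? (λ x → (x ∈? p) ×-dec (φ x ≟ y))
     | trans (sym (lookup∘tabulate (λ y → does (any? λ x → (x ∈? p) ×-dec (φ x ≟ y))) y)) ([]=⇒lookup y∈)
... | yes found | _ = found

range : (Fin m → Fin n) → Subset n
range φ = image φ full

∈-range⁺ : ∀ (φ : Fin m → Fin n) x → φ x ∈ range φ
∈-range⁺ φ x = ∈-image⁺ φ {x = x} ∈⊤

∈-range⁻ : ∀ (φ : Fin m → Fin n) {y} → y ∈ range φ → ∃ λ x → φ x ≡ y
∈-range⁻ φ y∈ with x , _ , eq ← ∈-image⁻ φ y∈ = x , eq

tabulate-enumerates-range : ∀ {φ : Fin m → Fin n} → Injective _≡_ _≡_ φ → tabulate φ Enumerates range φ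
tabulate-enumerates-range {φ = φ} inj = record
  { distinct = Unique.tabulate⁺ inj
  ; to       = λ x∈ → let i , x≡ = ∈-tabulate⁻ x∈ in subst (_∈ range φ) (sym x≡) (∈-range⁺ φ i)
  ; from     = λ x∈ → let i , φi≡x = ∈-range⁻ φ x∈ in subst (List._∈ tabulate φ) φi≡x (∈-tabulate⁺ i)
  }

∣range∣ : ∀ {φ : Fin m → Fin n} → Injective _≡_ _≡_ φ → ∣ range φ ∣ ≡ m
∣range∣ {φ = φ} inj = trans (sym (length-enumeration (tabulate-enumerates-range inj))) (length-tabulate φ)

enumerated-range : ∀ {xs} {p : Subset n} → xs Enumerates p → range (lookup xs) ≡ p
enumerated-range {xs = xs} {p} ex = ⊆-antisym
  (λ x∈ → let i , eq = ∈-range⁻ (lookup xs) x∈ in subst (_∈ p) eq (to ex (∈-lookup i)))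
  (λ x∈p → subst (_∈ range (lookup xs)) (sym (lookup-index (from ex x∈p))) (∈-range⁺ (lookup xs) (index (from ex x∈p))))

-- The edges of the crown are defined as ranges, so this reduces the computation of their images to
-- composing functions.
image-range : ∀ {k} (φ : Fin m → Fin n) (ψ : Fin k → Fin m) (χ : Fin k → Fin n) →
              (∀ i → φ (ψ i) ≡ χ i) → image φ (range ψ) ≡ range χ
image-range φ ψ χ eq = ⊆-antisym
  (λ y∈ → let x , x∈ , φx≡y = ∈-image⁻ φ y∈; i , ψi≡x = ∈-range⁻ ψ x∈
          in subst (_∈ range χ) (trans (sym (eq i)) (trans (cong φ ψi≡x) φx≡y)) (∈-range⁺ χ i))
  (λ y∈ → let i , χi≡y = ∈-range⁻ χ y∈
          in subst (_∈ image φ (range ψ)) (trans (eq i) χi≡y) (∈-image⁺ φ (∈-range⁺ ψ i)))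

range-surjective : ∀ (p : Subset n) → ∣ p ∣ ≡ r → ∃ λ (φ : Fin r → Fin n) → Injective _≡_ _≡_ φ × range φ ≡ p
range-surjective p refl rewrite sym (length-elements p) =
  lookup (elements p) , lookup-injective (distinct (elements-enumerates p)) , enumerated-range (elements-enumerates p)

-- The crown as a grid, and copies of it

-- c i is the position in spoke i of its point on the base.
module CrownOn (r : ℕ) (2≤r : 2 ≤ r) (c : Fin r → Fin r) where

  -- The r² vertices form a grid by way of `combine`. The rows are the spokes, and the base is a
  -- transversal with one point in each row.
  base : Subset (r * r)
  base = range λ i → combine i (c i)

  spoke : Fin r → Subset (r * r)
  spoke i = range (combine i)

  centre-injective : Injective _≡_ _≡_ λ i → combine i (c i)
  centre-injective {i} {j} = combine-injectiveˡ i (c i) j (c j)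

  ∈-spoke : ∀ {i y} → y ∈ spoke i → proj₁ (remQuot {r} r y) ≡ i
  ∈-spoke {i} y∈ with j , refl ← ∈-range⁻ (combine i) y∈ = cong proj₁ (remQuot-combine i j)

  spokes-disjoint : ∀ {i j} → i ≢ j → Disjoint (spoke i) (spoke j)
  spokes-disjoint i≢j (y , y∈) with y∈i , y∈j ← x∈p∩q⁻ _ _ y∈ =
    i≢j (trans (sym (∈-spoke y∈i)) (∈-spoke y∈j))

  base∩spoke : ∀ i → base ∩ spoke i ≡ ⁅ combine i (c i) ⁆
  base∩spoke i = ⊆-antisym only both
    where
    only : base ∩ spoke i ⊆ ⁅ combine i (c i) ⁆
    only y∈ with y∈base , y∈spoke ← x∈p∩q⁻ base (spoke i) y∈
            with j , refl ← ∈-range⁻ (λ i → combine i (c i)) y∈base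
            with refl ← trans (sym (cong proj₁ (remQuot-combine j (c j)))) (∈-spoke y∈spoke) = x∈⁅x⁆ _
    both : ⁅ combine i (c i) ⁆ ⊆ base ∩ spoke i
    both y∈ with refl ← x∈⁅y⁆⇒x≡y _ y∈ = x∈p∩q⁺ (∈-range⁺ (λ i → combine i (c i)) i , ∈-range⁺ (combine i) (c i))

  meets : ∀ i → ∣ base ∩ spoke i ∣ ≡ 1
  meets i = trans (cong ∣_∣ (base∩spoke i)) (∣⁅x⁆∣≡1 (combine i (c i)))


  lines : List (Subset (r * r))
  lines = base ∷ tabulate spoke

  ∣base∣ : ∣ base ∣ ≡ r
  ∣base∣ = ∣range∣ centre-injective

  -- Otherwise `base ∩ spoke i` would be all of `base`, with r ≥ 2 points instead of one.
  base≢spoke : ∀ i → base ≢ spoke i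
  base≢spoke i base≡ = contradiction 2≤1 λ { (s≤s ()) }
    where
    2≤1 : 2 ≤ 1
    2≤1 = begin
      2                    ≤⟨ 2≤r ⟩
      r                    ≡⟨ ∣base∣ ⟨
      ∣ base ∣             ≡⟨ cong ∣_∣ (∩-idem base) ⟨
      ∣ base ∩ base ∣      ≡⟨ cong (λ p → ∣ base ∩ p ∣) base≡ ⟩
      ∣ base ∩ spoke i ∣   ≡⟨ meets i ⟩
      1                    ∎
      where open ≤-Reasoning

  spoke-injective : Injective _≡_ _≡_ spoke
  spoke-injective {i} {j} eq =
    trans (sym (∈-spoke (∈-range⁺ (combine i) i))) (∈-spoke (subst (combine i i ∈_) eq (∈-range⁺ (combine i) i)))

  crown : RGraph r (r * r)
  crown = record
    { nonempty = m*n≢0 r r {{r≢0}} {{r≢0}}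
    ; edges    = lines
    ; unique   = Allₚ.tabulate⁺ base≢spoke ∷ Unique.tabulate⁺ spoke-injective
    ; uniform  = ∣base∣ ∷ Allₚ.tabulate⁺ λ i → ∣range∣ λ {j} {k} → combine-injectiveʳ i j i k
    }
    where
    r≢0 : NonZero r
    r≢0 = >-nonZero (≤-trans (s≤s z≤n) 2≤r)

  crown-linear : Linear crown
  crown-linear (here refl) (here refl) e≢f = contradiction refl e≢f
  crown-linear (here refl) (there f∈) _ with i , refl ← ∈-tabulate⁻ f∈ = ≤-reflexive (meets i)
  crown-linear (there e∈) (here refl) _ with i , refl ← ∈-tabulate⁻ e∈ =
    ≤-reflexive (trans (cong ∣_∣ (∩-comm (spoke i) base)) (meets i))
  crown-linear (there e∈) (there f∈) e≢f with i , refl ← ∈-tabulate⁻ e∈ | j , refl ← ∈-tabulate⁻ f∈ =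
    ≤-trans (≤-reflexive (trans (cong ∣_∣ (Empty-unique (spokes-disjoint (e≢f ∘ cong spoke)))) (∣⊥∣≡0 (r * r)))) z≤n

  isCrown : IsCrown crown
  isCrown = record
    { linear    = crown-linear
    ; spoke     = spoke
    ; base      = base
    ; edges-are = ↭-refl
    ; disjoint  = spokes-disjoint
    ; meets     = meets
    }

Disjoint-sym : Symmetric (Disjoint {n})
Disjoint-sym {x = p} {q} p#q (x , x∈) with x∈q , x∈p ← x∈p∩q⁻ q p x∈ = p#q (x , x∈p∩q⁺ (x∈p , x∈q))

-- Disjointness already forces `e` to meet each spoke only in its own vertex, as every other vertex
-- of `e` lies on another spoke. Numbering the vertices of each spoke then embeds the grid row by
-- row.
no-crown : (G : RGraph r n) → 2 ≤ r → CrownFree G →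
  ∀ {e} → e List.∈ edges G → (ps : List (Fin n × Subset n)) → map proj₁ ps Enumerates e →
  All (λ (u , f) → f List.∈ edges G × u ∈ f) ps → AllPairs (λ (_ , f) (_ , g) → Disjoint f g) ps → ⊥
no-crown {r} {n} G 2≤r cf {e} e∈E ps enum spokes disj = cf crown isCrown record
  { embed     = embed
  ; injective = embed-injective
  ; preserves = λ
    { (here refl) → subst (List._∈ edges G) (sym embed-base) e∈E
    ; (there f∈)  → let i , f≡ = ∈-tabulate⁻ f∈
                    in subst (λ f → image embed f List.∈ edges G) (sym f≡)
                         (subst (List._∈ edges G) (sym (embed-spoke i)) (s∈E i)) }
  }
  where
  r≡ : length ps ≡ r
  r≡ = trans (sym (length-map proj₁ ps)) (trans (length-enumeration enum) (All.lookup (uniform G) e∈E))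

  at : Fin r → Fin (length ps)
  at = cast (sym r≡)

  at-injective : ∀ {i j} → i ≢ j → at i ≢ at j
  at-injective {i} {j} i≢j eq = i≢j (toℕ-injective (trans (sym (toℕ-cast _ i)) (trans (cong toℕ eq) (toℕ-cast _ j))))

  v : Fin r → Fin n
  v i = proj₁ (lookup ps (at i))

  s : Fin r → Subset n
  s i = proj₂ (lookup ps (at i))

  s∈E : ∀ i → s i List.∈ edges G
  s∈E i = proj₁ (All.lookup spokes (∈-lookup (at i)))

  v∈s : ∀ i → v i ∈ s i
  v∈s i = proj₂ (All.lookup spokes (∈-lookup (at i)))

  s-disjoint : ∀ {i j} → i ≢ j → Disjoint (s i) (s j)
  s-disjoint i≢j = lookup-AllPairs (λ {x} {y} → Disjoint-sym {x = proj₂ x} {proj₂ y}) disj (at-injective i≢j)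

  numbering : ∀ i → ∃ λ (φ : Fin r → Fin n) → Injective _≡_ _≡_ φ × range φ ≡ s i
  numbering i = range-surjective (s i) (All.lookup (uniform G) (s∈E i))

  φ : Fin r → Fin r → Fin n
  φ i = proj₁ (numbering i)

  φ-injective : ∀ i → Injective _≡_ _≡_ (φ i)
  φ-injective i = proj₁ (proj₂ (numbering i))

  range-φ : ∀ i → range (φ i) ≡ s i
  range-φ i = proj₂ (proj₂ (numbering i))

  centre : ∀ i → ∃ λ j → φ i j ≡ v i
  centre i = ∈-range⁻ (φ i) (subst (v i ∈_) (sym (range-φ i)) (v∈s i))

  -- The base position in row `i` is the number of `v i` in the numbering of `s i`. With this choice
  -- the embedding sends `base` to `e`, without any adjustment of the numberings.
  open CrownOn r 2≤r (λ i → proj₁ (centre i))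

  embed : Fin (r * r) → Fin n
  embed y = uncurry φ (remQuot {r} r y)

  embed-combine : ∀ i j → embed (combine i j) ≡ φ i j
  embed-combine i j = cong (uncurry φ) (remQuot-combine i j)

  φ∈s : ∀ i j → φ i j ∈ s i
  φ∈s i j = subst (φ i j ∈_) (range-φ i) (∈-range⁺ (φ i) j)

  φ-injective₂ : ∀ i j i′ j′ → φ i j ≡ φ i′ j′ → (i , j) ≡ (i′ , j′)
  φ-injective₂ i j i′ j′ eq with i ≟ i′
  ... | yes refl = cong (i ,_) (φ-injective i eq)
  ... | no  i≢i′ = contradiction (φ i j , x∈p∩q⁺ (φ∈s i j , subst (_∈ s i′) (sym eq) (φ∈s i′ j′))) (s-disjoint i≢i′)

  embed-injective : Injective _≡_ _≡_ embed
  embed-injective {x} {y} eq =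
    trans (sym (combine-remQuot {r} r x))
      (trans (cong (uncurry combine) (φ-injective₂ _ _ _ _ eq)) (combine-remQuot {r} r y))

  embed-spoke : ∀ i → image embed (spoke i) ≡ s i
  embed-spoke i = trans (image-range embed (combine i) (φ i) (embed-combine i)) (range-φ i)

  range-v : range v ≡ e
  range-v = ⊆-antisym
    (λ x∈ → let i , eq = ∈-range⁻ v x∈ in subst (_∈ e) eq (to enum (∈-map⁺ proj₁ (∈-lookup (at i)))))
    (λ x∈e → let p , p∈ , x≡ = ∈-map⁻ proj₁ (from enum x∈e)
                 at-index = trans (cong (lookup ps) (cast-involutive (sym r≡) r≡ (index p∈))) (sym (lookup-index p∈))
                 eq = trans (cong proj₁ at-index) (sym x≡)
             in subst (_∈ range v) eq (∈-range⁺ v (cast r≡ (index p∈))))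

  embed-base : image embed base ≡ e
  embed-base = trans (image-range embed (λ i → combine i (proj₁ (centre i))) v
                       (λ i → trans (embed-combine i (proj₁ (centre i))) (proj₂ (centre i)))) range-v

-- Greedy choice of spokes

two-elements : ∀ {p : Subset n} {x y} → x ≢ y → x ∈ p → y ∈ p → 2 ≤ ∣ p ∣
two-elements {x = x} x≢y x∈p y∈p =
  ≤-trans (s≤s (≤-trans (s≤s z≤n) (x∈p⇒∣p-x∣<∣p∣ (x∈p∧x≢y⇒x∈p-y y∈p (x≢y ∘ sym))))) (x∈p⇒∣p-x∣<∣p∣ x∈p)

length-filter-¬ : ∀ {P : A → Set} (P? : Decidable P) {xs} → Unique xs →
  (∀ {x y} → x List.∈ xs → y List.∈ xs → P x → P y → x ≡ y) →
  length xs ≤ suc (length (filter (¬? ∘ P?) xs))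
length-filter-¬ P? []                    _      = z≤n
length-filter-¬ P? {x ∷ xs} (x∉ ∷ xs!) P-sub with P? x
... | no  _  = s≤s (length-filter-¬ P? xs! (λ x∈ y∈ → P-sub (there x∈) (there y∈)))
... | yes px = s≤s (≤-reflexive (cong length (sym (filter-all (¬? ∘ P?)
                 (All.tabulate λ y∈ py → All.lookup x∉ y∈ (P-sub (here refl) (there y∈) px py))))))

-- Each point of `us` lies in at most one set of `es`, so discarding the sets through it costs at
-- most one set per point.
avoid : (es : List (Subset n)) → Unique es → (us : List (Fin n)) →
  All (λ u → ∀ e f → e List.∈ es → f List.∈ es → u ∈ e → u ∈ f → e ≡ f) us → length us < length es →
  ∃ λ e → e List.∈ es × All (_∉ e) us
avoid (e ∷ _) _   []       _        _ = e , here refl , []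
avoid es      es! (u ∷ us) (≤1 ∷ ≤1s) lt
  with e , e∈ , us∉ ← avoid (filter (¬? ∘ (u ∈?_)) es) (Unique.filter⁺ (¬? ∘ (u ∈?_)) es!) us
         (All.map (λ ≤1 e f e∈ f∈ →
            ≤1 e f (proj₁ (∈-filter⁻ (¬? ∘ (u ∈?_)) e∈)) (proj₁ (∈-filter⁻ (¬? ∘ (u ∈?_)) f∈))) ≤1s)
         (≤-pred (≤-trans lt (length-filter-¬ (u ∈?_) es! (λ e∈ f∈ → ≤1 _ _ e∈ f∈))))
  with e∈es , u∉e ← ∈-filter⁻ (¬? ∘ (u ∈?_)) e∈ = e , e∈es , u∉e ∷ us∉

module _ (G : RGraph r n) (linear : Linear G) where

  edge-unique : ∀ {e f x y} → e List.∈ edges G → f List.∈ edges G → x ≢ y →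
                x ∈ e → y ∈ e → x ∈ f → y ∈ f → e ≡ f
  edge-unique {e} {f} e∈ f∈ x≢y x∈e y∈e x∈f y∈f with Vec-≡-dec _≟ᵇ_ e f
  ... | yes e≡f = e≡f
  ... | no  e≢f = contradiction (linear e∈ f∈ e≢f)
                    (<⇒≱ (two-elements x≢y (x∈p∩q⁺ (x∈e , x∈f)) (x∈p∩q⁺ (y∈e , y∈f))))

  -- By linearity another vertex shares at most one edge with `v`, so each entry of `us` spoils at
  -- most one edge at `v`.
  edge-avoiding : ∀ v us → All (_≢ v) us → length us < degree G v →
                  ∃ λ e → e List.∈ edges G × v ∈ e × All (_∉ e) us
  edge-avoiding v us us≢v lt
    with e , e∈ , us∉e ← avoid (filter (v ∈?_) (edges G)) (Unique.filter⁺ (v ∈?_) (unique G)) us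
           (All.map (λ u≢v e f e∈ f∈ u∈e u∈f →
              let e∈E , v∈e = ∈-filter⁻ (v ∈?_) e∈; f∈E , v∈f = ∈-filter⁻ (v ∈?_) f∈
              in edge-unique e∈E f∈E u≢v u∈e v∈e u∈f v∈f) us≢v) lt
    with e∈E , v∈e ← ∈-filter⁻ (v ∈?_) e∈ = e , e∈E , v∈e , us∉e

  -- j earlier spokes have j (r ∸ 1) vertices off the base, each on at most one edge through u; with the base
  -- itself, this excludes at most j (r ∸ 1) + 1 edges at u.
  Rich : ℕ → List (Fin n) → Set
  Rich j []       = ⊤
  Rich j (u ∷ us) = j * (r ∸ 1) + 2 ≤ degree G u × Rich (suc j) us

  -- Induction on the base vertices `us` still without a spoke. The spokes already chosen are `fs`,
  -- and `ws` contains their vertices off the base. The new spoke at `u` has to avoid `ws` and one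
  -- more vertex `o` of the base; the latter makes it different from `e`.
  greedy-spokes : ∀ {e} → e List.∈ edges G → (∀ u → ∃ λ o → o ∈ e × o ≢ u) →
    ∀ j us → Unique us → All (_∈ e) us → Rich j us →
    ∀ fs → All (λ u → All (u ∉_) fs) us →
    ∀ ws → length ws ≤ j * (r ∸ 1) → All (λ u → All (_≢ u) ws) us →
    All (λ f → ∀ w → w ∈ f → w List.∈ ws ⊎ w ∈ e) fs →
    ∃ λ ps → map proj₁ ps ≡ us × All (λ (u , f) → f List.∈ edges G × u ∈ f) ps ×
             AllPairs (λ (_ , f) (_ , g) → Disjoint f g) ps × All (λ (_ , f) → All (Disjoint f) fs) ps
  greedy-spokes e∈E other j [] _ _ _ fs _ ws _ _ _ = [] , refl , [] , [] , []
  greedy-spokes {e} e∈E other j (u ∷ us) (u≢us ∷ us!) (u∈e ∷ us∈e) (rich , riches)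
                fs (u∉fs ∷ us∉fs) ws ∣ws∣≤ (ws≢u ∷ ws≢us) fs⊆ =
    let o , o∈e , o≢u = other u
        g , g∈E , u∈g , ows∉g = edge-avoiding u (o ∷ ws) (o≢u ∷ ws≢u)
          (≤-trans (s≤s (s≤s ∣ws∣≤)) (≤-trans (≤-reflexive (+-comm 2 (j * (r ∸ 1)))) rich))
        -- A second common vertex would make `g` equal to `e`, but `o` is on `e` and not on `g`.
        g∩e : ∀ {w} → w ∈ g → w ∈ e → w ≡ u
        g∩e {w} w∈g w∈e =
          [ id
          , (λ w≢u → contradiction (subst (o ∈_) (edge-unique e∈E g∈E w≢u w∈e u∈e w∈g u∈g) o∈e) (All.head ows∉g))
          ]′ (toSum (w ≟ u))
        us∉g = All.zipWith (λ (u≢u′ , u′∈e) u′∈g → u≢u′ (sym (g∩e u′∈g u′∈e))) (u≢us , us∈e)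
        -- A vertex common to `g` and an earlier spoke would be in `ws`, which `g` avoids, or on
        -- `e`; then it would be `u`, which lies on no earlier spoke.
        g#fs = All.tabulate λ {f} f∈ (w , w∈) →
          let w∈g , w∈f = x∈p∩q⁻ g f w∈
          in [ (λ w∈ws → All.lookup (All.tail ows∉g) w∈ws w∈g)
             , (λ w∈e → All.lookup u∉fs f∈ (subst (_∈ f) (g∩e w∈g w∈e) w∈f)) ]′ (All.lookup fs⊆ f∈ w w∈f)
        ps , ps₁ , spokes , disj , ps#gfs = greedy-spokes e∈E other (suc j) us us! us∈e riches
          (g ∷ fs) (All.zipWith (λ (u∉g , u∉fs) → u∉g ∷ u∉fs) (us∉g , us∉fs))
          (elements (g - u) ++ ws)
          (begin
            length (elements (g - u) ++ ws)      ≡⟨ length-++ (elements (g - u)) ⟩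
            length (elements (g - u)) + length ws ≤⟨ +-mono-≤ (∣g-u∣≤ g∈E u∈g) ∣ws∣≤ ⟩
            (r ∸ 1) + j * (r ∸ 1)                ∎)
          (All.zipWith (λ (u′∉g , ws≢u′) → Allₚ.++⁺
             (All.tabulate λ w∈ w≡u′ →
               u′∉g (subst (_∈ g) w≡u′ (p─q⊆p g _ (to (elements-enumerates (g - u)) w∈)))) ws≢u′) (us∉g , ws≢us))
          ((λ w w∈g → [ (λ w≡u → inj₂ (subst (_∈ e) (sym w≡u) u∈e))
                        , (λ w≢u → inj₁ (∈-++⁺ˡ (from (elements-enumerates (g - u)) (x∈p∧x≢y⇒x∈p-y w∈g w≢u))))
                        ]′ (toSum (w ≟ u)))
            ∷ All.map (λ f⊆ w w∈f → [ inj₁ ∘ ∈-++⁺ʳ (elements (g - u)) , inj₂ ]′ (f⊆ w w∈f)) fs⊆)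
    in (u , g) ∷ ps , cong (u ∷_) ps₁ , (g∈E , u∈g) ∷ spokes ,
       All.map (λ {p} f#gfs → Disjoint-sym {x = proj₂ p} {g} (All.head f#gfs)) ps#gfs ∷ disj ,
       g#fs ∷ All.map All.tail ps#gfs
    where
    open ≤-Reasoning
    ∣g-u∣≤ : ∀ {g} → g List.∈ edges G → u ∈ g → length (elements (g - u)) ≤ r ∸ 1
    ∣g-u∣≤ {g} g∈E u∈g = begin
      length (elements (g - u)) ≡⟨ length-elements (g - u) ⟩
      ∣ g - u ∣                 ≤⟨ suc[m]≤n⇒m≤pred[n] (x∈p⇒∣p-x∣<∣p∣ u∈g) ⟩
      pred ∣ g ∣                ≡⟨ cong pred (All.lookup (uniform G) g∈E) ⟩
      pred r                    ≡⟨⟩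
      r ∸ 1                     ∎

  other-vertex : 2 ≤ r → ∀ {e} → e List.∈ edges G → ∀ u → ∃ λ o → o ∈ e × o ≢ u
  other-vertex 2≤r {e} e∈E u
    with elements e | elements-enumerates e | trans (length-elements e) (All.lookup (uniform G) e∈E)
  ... | []        | _  | refl = contradiction 2≤r λ ()
  ... | _ ∷ []    | _  | refl = contradiction 2≤r λ { (s≤s ()) }
  ... | x ∷ y ∷ _ | en | _    with x ≟ u
  ... | no  x≢u  = x , to en (here refl) , x≢u
  ... | yes refl = y , to en (there (here refl)) , λ { refl → contradiction refl (All.head (AllPairs.head (distinct en))) }

  ¬rich : 2 ≤ r → CrownFree G → ∀ {e us} → e List.∈ edges G → us Enumerates e → ¬ Rich 0 us
  ¬rich 2≤r cf {us = us} e∈E en rich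
    with ps , refl , spokes , disj , _ ←
           greedy-spokes e∈E (other-vertex 2≤r e∈E) 0 us (distinct en) (All.tabulate (to en)) rich
           [] (All.universal (λ _ → []) us) [] z≤n (All.universal (λ _ → []) us) []
    = no-crown G 2≤r cf e∈E ps en spokes disj

-- Double counting

sum-zeros : (xs : List A) → sum (map (λ _ → 0) xs) ≡ 0
sum-zeros []       = refl
sum-zeros (_ ∷ xs) = sum-zeros xs

sum-const-≤ : ∀ {c} {f : A → ℕ} {xs} → All (λ x → c ≤ f x) xs → length xs * c ≤ sum (map f xs)
sum-const-≤ []           = z≤n
sum-const-≤ (c≤fx ∷ all) = +-mono-≤ c≤fx (sum-const-≤ all)

sum-≤-const : ∀ {c} {f : A → ℕ} {xs} → All (λ x → f x ≤ c) xs → sum (map f xs) ≤ length xs * c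
sum-≤-const []           = z≤n
sum-≤-const (fx≤c ∷ all) = +-mono-≤ fx≤c (sum-≤-const all)

sum-≤-support : ∀ {c} {P : A → Set} (P? : Decidable P) {f : A → ℕ} → (∀ x → f x ≤ c) → (∀ x → P x → f x ≡ 0) →
  ∀ xs → sum (map f xs) ≤ c * (length xs ∸ length (filter P? xs))
sum-≤-support P? f≤c f≡0 []       = z≤n
sum-≤-support {c = c} P? {f} f≤c f≡0 (x ∷ xs) with P? x
... | yes px rewrite f≡0 x px = sum-≤-support P? f≤c f≡0 xs
... | no  _  rewrite +-∸-assoc 1 (length-filter P? xs) | *-suc c (length xs ∸ length (filter P? xs)) =
  +-mono-≤ (f≤c x) (sum-≤-support P? f≤c f≡0 xs)

module _ {R : A → B → Set} (R? : ∀ x y → Dec (R x y)) (f : A → B → ℕ) where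

  -- Both sides add up `f` over the related pairs. The induction on `xs` splits off one row, which
  -- `add` distributes over the columns.
  sum-swap : ∀ xs ys → sum (map (λ x → sum (map (f x) (filter (R? x) ys))) xs)
                     ≡ sum (map (λ y → sum (map (λ x → f x y) (filter (λ x → R? x y) xs))) ys)
  sum-swap []       ys = sym (sum-zeros ys)
  sum-swap (x ∷ xs) ys = trans (cong (λ k → sum (map (f x) (filter (R? x) ys)) + k) (sum-swap xs ys)) (add ys)
    where
    g : List A → B → ℕ
    g xs y = sum (map (λ x → f x y) (filter (λ x → R? x y) xs))
    add : ∀ ys → sum (map (f x) (filter (R? x) ys)) + sum (map (g xs) ys) ≡ sum (map (g (x ∷ xs)) ys)
    add []       = refl
    add (y ∷ ys) with R? x y
    ... | yes _ = trans (interchange (f x y) (sum (map (f x) (filter (R? x) ys))) (g xs y) (sum (map (g xs) ys)))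
                        (cong (λ k → f x y + g xs y + k) (add ys))
      where
      interchange : ∀ a b c d → a + b + (c + d) ≡ a + c + (b + d)
      interchange = solve-∀
    ... | no  _ = trans (swap-left (sum (map (f x) (filter (R? x) ys))) (g xs y) (sum (map (g xs) ys)))
                        (cong (λ k → g xs y + k) (add ys))
      where
      swap-left : ∀ b c d → b + (c + d) ≡ c + (b + d)
      swap-left = solve-∀

module _ (G : RGraph r n) where

  ByDegree : List (Fin n) → Set
  ByDegree = AllPairs λ u v → degree G u ≤ degree G v

  sorted-elements : (e : Subset n) → ∃ λ us → us Enumerates e × ByDegree us × elements e ↭ us
  sorted-elements e = sort (elements e) ,
    record
      { distinct = Unique-resp-↭ (setoid _) (↭⇒↭ₛ (↭-sym (sort-↭ _))) (distinct en)
      ; to       = to en ∘ ∈-resp-↭ (sort-↭ _)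
      ; from     = ∈-resp-↭ (↭-sym (sort-↭ _)) ∘ from en
      } ,
    Sorted⇒AllPairs totalOrder (sort-↗ (elements e)) , ↭-sym (sort-↭ (elements e))
    where
    en = elements-enumerates e
    order = On.decTotalOrder ≤-decTotalOrder (degree G)
    open Data.List.Sort order using (sort; sort-↭; sort-↗)
    open DecTotalOrder order using (totalOrder)

  -- The vertices counted by s give nothing, so that only the remaining n - s vertices pay for the
  -- edges.
  capped : ℕ → (Fin n → Subset n → ℕ) → Fin n → Subset n → ℕ
  capped d f v e with d ≤? degree G v
  ... | yes _ = 0
  ... | no  _ = f v e

  capped-low : ∀ {d} f {v e} → degree G v < d → capped d f v e ≡ f v e
  capped-low {d} f {v} v<d with d ≤? degree G v
  ... | yes d≤v = contradiction d≤v (<⇒≱ v<d)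
  ... | no  _   = refl

  -- The capped weights of all incidences are summed by edges for the lower bound and by vertices
  -- for the upper one. An edge may be examined with its vertices sorted by degree, since the order
  -- does not affect its sum.
  double-counting : ∀ d (f : Fin n → Subset n → ℕ) {a b} →
    (∀ v → degree G v < d → sum (map (f v) (filter (v ∈?_) (edges G))) ≤ a) →
    (∀ {e us} → e List.∈ edges G → us Enumerates e → ByDegree us → b ≤ sum (map (λ v → capped d f v e) us)) →
    b * ∣E G ∣ ≤ a * (n ∸ #degree≥ d G)
  double-counting d f {a} {b} vertex≤a edge≥b = begin
    b * ∣E G ∣
      ≡⟨ *-comm b _ ⟩
    ∣E G ∣ * b
      ≤⟨ sum-const-≤ (All.tabulate edge) ⟩
    sum (map (λ e → sum (map (λ v → capped d f v e) (elements e))) (edges G))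
      ≡⟨ sum-swap _∈?_ (capped d f) (allFin n) (edges G) ⟨
    sum (map load (allFin n))
      ≤⟨ sum-≤-support (λ v → d ≤? degree G v) load≤a load≡0 (allFin n) ⟩
    a * (length (allFin n) ∸ #degree≥ d G)
      ≡⟨ cong (λ k → a * (k ∸ #degree≥ d G)) (length-tabulate {n = n} id) ⟩
    a * (n ∸ #degree≥ d G) ∎
    where
    open ≤-Reasoning
    load : Fin n → ℕ
    load v = sum (map (capped d f v) (filter (v ∈?_) (edges G)))
    load≡0 : ∀ v → d ≤ degree G v → load v ≡ 0
    load≡0 v d≤v with d ≤? degree G v
    ... | yes _   = sum-zeros (filter (v ∈?_) (edges G))
    ... | no  d≰v = contradiction d≤v d≰v
    load≤a : ∀ v → load v ≤ a
    load≤a v with d ≤? degree G v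
    ... | yes _   = ≤-trans (≤-reflexive (sum-zeros (filter (v ∈?_) (edges G)))) z≤n
    ... | no  d≰v = vertex≤a v (≰⇒> d≰v)
    edge : ∀ {e} → e List.∈ edges G → b ≤ sum (map (λ v → capped d f v e) (elements e))
    edge {e} e∈E with us , en , sorted , p ← sorted-elements e =
      ≤-trans (edge≥b e∈E en sorted) (≤-reflexive (sym (sum-↭ (map⁺ _ p))))

  Low : ℕ → Fin n → Set
  Low k v = degree G v ≤ k

  module _ (linear : Linear G) where

    -- At the first vertex violating `Rich` the degree is small, and by sortedness so are the
    -- degrees of all vertices before it.
    poor-prefix : ∀ j us → ByDegree us → ¬ Rich G linear j us →
      ∃ λ i → ∃₂ λ xs ys → us ≡ xs ++ ys × length xs ≡ suc i × All (Low ((j + i) * (r ∸ 1) + 1)) xs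
    poor-prefix j []       _ poor = contradiction tt poor
    poor-prefix j (u ∷ us) (u≤us ∷ sorted) poor with j * (r ∸ 1) + 2 ≤? degree G u
    ... | no  ¬rich = 0 , u ∷ [] , us , refl , refl ,
            subst (λ j → degree G u ≤ j * (r ∸ 1) + 1) (sym (+-identityʳ j))
              (≤-pred (≤-trans (≰⇒> ¬rich) (≤-reflexive (+-suc (j * (r ∸ 1)) 1)))) ∷ []
    ... | yes rich with poor-prefix (suc j) us sorted (λ riches → poor (rich , riches))
    ... | i , x ∷ xs , ys , refl , eq , x≤k ∷ low = suc i , u ∷ x ∷ xs , ys , refl , cong suc eq ,
            subst (λ l → All (Low (l * (r ∸ 1) + 1)) (u ∷ x ∷ xs)) (sym (+-suc j i))
              (≤-trans (All.head u≤us) x≤k ∷ x≤k ∷ low)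

    poor-prefix₀ : 2 ≤ r → CrownFree G → ∀ {e us} → e List.∈ edges G → us Enumerates e → ByDegree us →
      ∃ λ i → ∃₂ λ xs ys → us ≡ xs ++ ys × length xs ≡ suc i × suc i ≤ r × All (Low (i * (r ∸ 1) + 1)) xs
    poor-prefix₀ 2≤r cf {e} {us} e∈E en sorted
      with i , xs , ys , refl , eq , low ← poor-prefix 0 us sorted (¬rich G linear 2≤r cf e∈E en)
      = i , xs , ys , refl , eq ,
        subst₂ _≤_ eq (trans (sym (length-++ xs)) (trans (length-enumeration en) (All.lookup (uniform G) e∈E)))
          (m≤m+n (length xs) (length ys)) ,
        low

-- The case r ≥ 4

-- The vertex v gives (t !) / degree v to each of its edges, scaled by the right-hand coefficient r (r ∸ 2).
bound-r≥4 : ∀ {m} → 2 ≤ m → (G : RGraph (2 + m) n) → Linear G → CrownFree G →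
  (1 + m) * ∣E G ∣ ≤ (2 + m) * m * (n ∸ #degree≥ ((1 + m) ^ 2 + 2) G)
bound-r≥4 {n} {m} 2≤m G linear cf =
  *-cancelˡ-≤ (t !) {{t !≢0}} (begin
    t ! * ((1 + m) * ∣E G ∣)         ≡⟨ regroup (t !) (1 + m) ∣E G ∣ ⟩
    (1 + m) * t ! * ∣E G ∣           ≤⟨ double-counting G d weight vertex edge ⟩
    R * t ! * (n ∸ #degree≥ d G)     ≡⟨ regroup (t !) R _ ⟨
    t ! * (R * (n ∸ #degree≥ d G))   ∎)
  where
  open ≤-Reasoning
  d t R : ℕ
  d = (1 + m) ^ 2 + 2
  t = (1 + m) ^ 2 + 1
  R = (2 + m) * m

  regroup : ∀ a b c → a * (b * c) ≡ b * a * c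
  regroup = solve-∀

  -- The argument is one less than the degree, which keeps the divisor nonzero. The factorial clears
  -- the denominators of all degrees up to `t`.
  share : ℕ → ℕ
  share k = t ! / suc k

  weight : Fin n → Subset n → ℕ
  weight v _ = R * share (pred (degree G v))

  k*share : ∀ k → k * (R * share (pred k)) ≤ R * t !
  k*share zero    = z≤n
  k*share (suc k) = begin
    suc k * (R * share k)  ≡⟨ regroup′ (suc k) R (share k) ⟩
    R * (share k * suc k)  ≤⟨ *-monoʳ-≤ R (m/n*n≤m (t !) (suc k)) ⟩
    R * t !                ∎
    where
    regroup′ : ∀ a b c → a * (b * c) ≡ b * (c * a)
    regroup′ = solve-∀

  vertex : ∀ v → degree G v < d → sum (map (weight v) (filter (v ∈?_) (edges G))) ≤ R * t !
  vertex v _ = ≤-trans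
    (sum-≤-const {f = weight v} (All.universal (λ _ → ≤-refl) (filter (v ∈?_) (edges G))))
    (k*share (degree G v))

  -- This says that `suc i` vertices of degree at most i (r - 1) + 1 give an edge enough. The right
  -- side exceeds the left by m² + m - 1 - i, which is m² - 2 at the extreme i = 1 + m. That is
  -- negative for m = 1, hence the restriction to r ≥ 4.
  enough : ∀ {i} → i ≤ 1 + m → (1 + m) * suc (i * (1 + m)) ≤ suc i * R
  enough {i} i≤ = begin
    (1 + m) * suc (i * (1 + m))      ≡⟨ lhs m i ⟩
    i * R + (i + m + 1)              ≤⟨ +-monoʳ-≤ (i * R) (+-monoˡ-≤ 1 (+-monoˡ-≤ m i≤)) ⟩
    i * R + (1 + m + m + 1)          ≡⟨ cong (λ k → i * R + k) (mid m) ⟩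
    i * R + (2 + 2 * m)              ≤⟨ +-monoʳ-≤ (i * R) (+-monoˡ-≤ (2 * m) (≤-trans 2≤m m≤m²)) ⟩
    i * R + (m * m + 2 * m)          ≡⟨ rhs m i ⟩
    suc i * R                        ∎
    where
    m≤m² : m ≤ m * m
    m≤m² = m≤m*n m m {{>-nonZero (≤-trans (s≤s z≤n) 2≤m)}}
    lhs : ∀ m i → (1 + m) * suc (i * (1 + m)) ≡ i * ((2 + m) * m) + (i + m + 1)
    lhs = solve-∀
    mid : ∀ m → 1 + m + m + 1 ≡ 2 + 2 * m
    mid = solve-∀
    rhs : ∀ m i → i * ((2 + m) * m) + (m * m + 2 * m) ≡ suc i * ((2 + m) * m)
    rhs = solve-∀

  edge : ∀ {e us} → e List.∈ edges G → us Enumerates e → ByDegree G us →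
         (1 + m) * t ! ≤ sum (map (λ v → capped G d weight v e) us)
  edge {e} e∈E en sorted
    with i , xs , ys , refl , ∣xs∣ , s≤s i≤ , low ← poor-prefix₀ G linear (s≤s (s≤s z≤n)) cf e∈E en sorted = begin
      -- The division is exact here, since `suc k` is at most `t` and so divides `t !`. Only the
      -- poor prefix `xs` is counted; what `ys` gives is dropped.
      (1 + m) * t !                        ≡⟨ cong ((1 + m) *_) (m/n*n≡m (∣-trans (m∣m*n (k !)) (m≤n⇒m!∣n! k<t))) ⟨
      (1 + m) * (share k * suc k)          ≡⟨ assoc (1 + m) (share k) (suc k) ⟩
      (1 + m) * suc k * share k            ≤⟨ *-monoˡ-≤ (share k) (enough i≤) ⟩
      suc i * R * share k                  ≡⟨ *-assoc (suc i) R (share k) ⟩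
      suc i * (R * share k)                ≡⟨ cong (_* (R * share k)) ∣xs∣ ⟨
      length xs * (R * share k)            ≤⟨ sum-const-≤ (All.map contributes low) ⟩
      sum (map c xs)                       ≤⟨ m≤m+n _ (sum (map c ys)) ⟩
      sum (map c xs) + sum (map c ys)      ≡⟨ sum-++ (map c xs) (map c ys) ⟨
      sum (map c xs ++ map c ys)           ≡⟨ cong sum (map-++ c xs ys) ⟨
      sum (map c (xs ++ ys))               ∎
    where
    k : ℕ
    k = i * (1 + m)
    c : Fin n → ℕ
    c v = capped G d weight v e
    assoc : ∀ a b c → a * (b * c) ≡ a * c * b
    assoc = solve-∀
    k<t : suc k ≤ t
    k<t = begin
      suc (i * (1 + m))           ≤⟨ s≤s (*-monoˡ-≤ (1 + m) i≤) ⟩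
      suc ((1 + m) * (1 + m))     ≡⟨ square m ⟩
      t                           ∎
      where
      square : ∀ m → suc ((1 + m) * (1 + m)) ≡ (1 + m) * ((1 + m) * 1) + 1
      square = solve-∀
    contributes : ∀ {v} → Low G (k + 1) v → R * share k ≤ c v
    contributes {v} v≤k = ≤-trans
      (*-monoʳ-≤ R (/-monoʳ-≤ (t !) (s≤s (≤-trans (pred-mono-≤ v≤k) (≤-reflexive (cong pred (+-comm k 1)))))))
      (≤-reflexive (sym (capped-low G weight (begin
        suc (degree G v)   ≤⟨ s≤s v≤k ⟩
        suc (k + 1)        ≡⟨ cong suc (+-comm k 1) ⟩
        suc (suc k)        ≤⟨ s≤s k<t ⟩
        suc t              ≡⟨ +-suc ((1 + m) ^ 2) 1 ⟨
        d                  ∎))))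

-- The case r = 3

module Triples (G : RGraph 3 n) (linear : Linear G) (crown-free : CrownFree G) where

  private
    variable
      a b c p q s u v w x y z p′ p″ a′ b′ c′ : Fin n

  -- The vertices of the edge come in an order, so that each can be given a role; `swap₁₂` and
  -- `swap₂₃` generate all reorderings.
  record Line (x y z : Fin n) : Set where
    constructor line
    field
      {edge} : Subset n
      edge∈  : edge List.∈ edges G
      enum   : (x ∷ y ∷ z ∷ []) Enumerates edge

  open Line

  enumerates-swap₁₂ : ∀ {e} → (x ∷ y ∷ z ∷ []) Enumerates e → (y ∷ x ∷ z ∷ []) Enumerates e
  enumerates-swap₁₂ en with (x≢y ∷ x≢z ∷ []) ∷ (y≢z ∷ []) ∷ [] ∷ [] ← distinct en = record
    { distinct = ((x≢y ∘ sym) ∷ y≢z ∷ []) ∷ (x≢z ∷ []) ∷ [] ∷ []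
    ; to       = to en ∘ flip
    ; from     = flip ∘ from en
    }
    where
    flip : ∀ {u x y z} → u List.∈ x ∷ y ∷ z ∷ [] → u List.∈ y ∷ x ∷ z ∷ []
    flip (here refl)                 = there (here refl)
    flip (there (here refl))         = here refl
    flip (there (there (here refl))) = there (there (here refl))

  enumerates-swap₂₃ : ∀ {e} → (x ∷ y ∷ z ∷ []) Enumerates e → (x ∷ z ∷ y ∷ []) Enumerates e
  enumerates-swap₂₃ en with (x≢y ∷ x≢z ∷ []) ∷ (y≢z ∷ []) ∷ [] ∷ [] ← distinct en = record
    { distinct = (x≢z ∷ x≢y ∷ []) ∷ ((y≢z ∘ sym) ∷ []) ∷ [] ∷ []
    ; to       = to en ∘ flip
    ; from     = flip ∘ from en
    }
    where
    flip : ∀ {u x y z} → u List.∈ x ∷ y ∷ z ∷ [] → u List.∈ x ∷ z ∷ y ∷ []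
    flip (here refl)                 = here refl
    flip (there (here refl))         = there (there (here refl))
    flip (there (there (here refl))) = there (here refl)

  swap₁₂ : Line x y z → Line y x z
  swap₁₂ (line e∈ en) = line e∈ (enumerates-swap₁₂ en)

  swap₂₃ : Line x y z → Line x z y
  swap₂₃ (line e∈ en) = line e∈ (enumerates-swap₂₃ en)

  rotate : Line x y z → Line y z x
  rotate = swap₂₃ ∘ swap₁₂

  rotate² : Line x y z → Line z x y
  rotate² = rotate ∘ rotate

  ≢₁₂ : Line x y z → x ≢ y
  ≢₁₂ l with (x≢y ∷ _) ∷ _ ← distinct (enum l) = x≢y

  ≢₂₃ : Line x y z → y ≢ z
  ≢₂₃ = ≢₁₂ ∘ rotate

  ≢₁₃ : Line x y z → x ≢ z
  ≢₁₃ = ≢₁₂ ∘ swap₂₃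

  -- By linearity two points lie on at most one edge. Most inequalities below come from this: a
  -- coincidence of points would make two lines share two points.
  third : Line x y z → Line x y w → z ≡ w
  third l l′ with refl ← edge-unique G linear (edge∈ l) (edge∈ l′) (≢₁₂ l)
                           (to (enum l) (here refl)) (to (enum l) (there (here refl)))
                           (to (enum l′) (here refl)) (to (enum l′) (there (here refl)))
             with from (enum l′) (to (enum l) (there (there (here refl))))
  ... | here refl                 = contradiction refl (≢₁₃ l)
  ... | there (here refl)         = contradiction refl (≢₂₃ l)
  ... | there (there (here refl)) = refl

  line-through : ∀ {e v} → e List.∈ edges G → v ∈ e → ∃₂ λ p q → (v ∷ p ∷ q ∷ []) Enumerates e
  line-through {e} {v} e∈E v∈e
    with elements e | elements-enumerates e | trans (length-elements e) (All.lookup (uniform G) e∈E)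
  ... | x ∷ y ∷ z ∷ [] | en | refl with from en v∈e
  ... | here refl                 = y , z , en
  ... | there (here refl)         = x , z , enumerates-swap₁₂ en
  ... | there (there (here refl)) = x , y , enumerates-swap₁₂ (enumerates-swap₂₃ en)

  line-avoiding : ∀ v us → All (_≢ v) us → length us < degree G v →
                  ∃₂ λ p q → Line v p q × All (_≢ p) us × All (_≢ q) us
  line-avoiding v us us≢v lt
    with e , e∈E , v∈e , us∉e ← edge-avoiding G linear v us us≢v lt
    with p , q , en ← line-through e∈E v∈e =
      p , q , line e∈E en ,
      All.map (λ { u∉e refl → u∉e (to en (there (here refl))) }) us∉e ,
      All.map (λ { u∉e refl → u∉e (to en (there (there (here refl)))) }) us∉e

  line? : v ≢ u → Dec (∃ λ t → Line v u t)
  line? {v} {u} v≢u with Any.any? (λ e → (v ∈? e) ×-dec (u ∈? e)) (edges G)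
  ... | no ¬found = no λ (_ , l) →
    ¬found (List.lose (edge∈ l) (to (enum l) (here refl) , to (enum l) (there (here refl))))
  ... | yes found with e , e∈E , v∈e , u∈e ← List.find found
                  with p , q , en ← line-through e∈E v∈e
                  with from en u∈e
  ... | here refl                 = contradiction refl v≢u
  ... | there (here refl)         = yes (q , line e∈E en)
  ... | there (there (here refl)) = yes (p , swap₂₃ (line e∈E en))

  line-of : ∀ {e} → e List.∈ edges G → x ∈ e → y ∈ e → z ∈ e → x ≢ y → y ≢ z → x ≢ z → Line x y z
  line-of e∈E x∈e y∈e z∈e x≢y y≢z x≢z with p , q , en ← line-through e∈E x∈e with from en y∈e | from en z∈e
  ... | here refl                 | _                         = contradiction refl x≢y
  ... | _                         | here refl                 = contradiction refl x≢z
  ... | there (here refl)         | there (here refl)         = contradiction refl y≢z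
  ... | there (here refl)         | there (there (here refl)) = line e∈E en
  ... | there (there (here refl)) | there (here refl)         = swap₂₃ (line e∈E en)
  ... | there (there (here refl)) | there (there (here refl)) = contradiction refl y≢z

  off-base : Line x y z → Line x a w → a ≢ y → a ≢ z → w ≢ y × w ≢ z
  off-base l l′ a≢y a≢z =
    (λ { refl → a≢z (third (swap₂₃ l′) l) }) , (λ { refl → a≢y (third (swap₂₃ l′) (swap₂₃ l)) })

  lines-disjoint : ∀ {x y z a b c} (l : Line x y z) (l′ : Line a b c) →
    All (λ u → All (u ≢_) (a ∷ b ∷ c ∷ [])) (x ∷ y ∷ z ∷ []) → Disjoint (edge l) (edge l′)
  lines-disjoint l l′ apart (u , u∈) with u∈e , u∈f ← x∈p∩q⁻ (edge l) (edge l′) u∈ =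
    All.lookup (All.lookup apart (from (enum l) u∈e)) (from (enum l′) u∈f) refl

  no-crown-at : Line x y z → Line x a a′ → Line y b b′ → Line z c c′ →
    a ≢ y → a ≢ z → b ≢ x → b ≢ z → c ≢ x → c ≢ y →
    All (λ u → All (u ≢_) (b ∷ b′ ∷ [])) (a ∷ a′ ∷ []) →
    All (λ u → All (u ≢_) (c ∷ c′ ∷ [])) (a ∷ a′ ∷ []) →
    All (λ u → All (u ≢_) (c ∷ c′ ∷ [])) (b ∷ b′ ∷ []) → ⊥
  no-crown-at l la lb lc a≢y a≢z b≢x b≢z c≢x c≢y
    ((ab ∷ ab′ ∷ []) ∷ (a′b ∷ a′b′ ∷ []) ∷ []) (a#c ∷ a′#c ∷ []) (b#c ∷ b′#c ∷ [])
    with a′≢y , a′≢z ← off-base l la a≢y a≢z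
       | b′≢x , b′≢z ← off-base (swap₁₂ l) lb b≢x b≢z
       | c′≢x , c′≢y ← off-base (rotate² l) lc c≢x c≢y
    = no-crown G (s≤s (s≤s z≤n)) crown-free (edge∈ l) ((_ , edge la) ∷ (_ , edge lb) ∷ (_ , edge lc) ∷ []) (enum l)
        ((edge∈ la , to (enum la) (here refl)) ∷ (edge∈ lb , to (enum lb) (here refl)) ∷ (edge∈ lc , to (enum lc) (here refl)) ∷ [])
        ((lines-disjoint la lb
            ((≢₁₂ l ∷ (b≢x ∘ sym) ∷ (b′≢x ∘ sym) ∷ []) ∷ (a≢y ∷ ab ∷ ab′ ∷ []) ∷ (a′≢y ∷ a′b ∷ a′b′ ∷ []) ∷ []) ∷
          lines-disjoint la lc ((≢₁₃ l ∷ (c≢x ∘ sym) ∷ (c′≢x ∘ sym) ∷ []) ∷ (a≢z ∷ a#c) ∷ (a′≢z ∷ a′#c) ∷ []) ∷ []) ∷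
         (lines-disjoint lb lc ((≢₂₃ l ∷ (c≢y ∘ sym) ∷ (c′≢y ∘ sym) ∷ []) ∷ (b≢z ∷ b#c) ∷ (b′≢z ∷ b′#c) ∷ []) ∷ []) ∷
         [] ∷ [])

  -- A line through z that avoids us avoids u as well.
  Blocked : Fin n → List (Fin n) → Fin n → Set
  Blocked z us u = u List.∈ us ⊎ (∀ t → Line z u t → t List.∈ us)

  -- The third spoke comes from `line-avoiding` at `z`. Listing all five points would require degree
  -- 6, so points that are blocked for another reason are left out of `us`. The point `y` is missed
  -- automatically, because the line through `z` and `y` is the base and contains `x`.
  no-crown-avoiding : Line x y z → Line x a a′ → Line y b b′ → a ≢ y → a ≢ z → b ≢ x → b ≢ z →
    All (λ u → All (u ≢_) (b ∷ b′ ∷ [])) (a ∷ a′ ∷ []) →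
    ∀ us → All (_≢ z) us → length us < degree G z → All (Blocked z us) (x ∷ a ∷ a′ ∷ b ∷ b′ ∷ []) → ⊥
  no-crown-avoiding {x} {y} {z} l la lb a≢y a≢z b≢x b≢z a#b us us≢z lt (x! ∷ a! ∷ a′! ∷ b! ∷ b′! ∷ [])
    with c , c′ , lc , us≢c , us≢c′ ← line-avoiding z us us≢z lt
    = no-crown-at l la lb lc a≢y a≢z b≢x b≢z
        (proj₁ x# ∘ sym) (λ { refl → proj₂ x# (sym (third lc (swap₂₃ (rotate² l)))) })
        a#b (≢s a! ∷ ≢s a′! ∷ []) (≢s b! ∷ ≢s b′! ∷ [])
    where
    avoids : ∀ {u} → Blocked z us u → u ≢ c × u ≢ c′
    avoids (inj₁ u∈us)   = All.lookup us≢c u∈us , All.lookup us≢c′ u∈us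
    avoids (inj₂ blocks) =
      (λ { refl → All.lookup us≢c′ (blocks _ lc) refl }) ,
      (λ { refl → All.lookup us≢c (blocks _ (swap₂₃ lc)) refl })
    ≢s : ∀ {u} → Blocked z us u → All (u ≢_) (c ∷ c′ ∷ [])
    ≢s blocked = proj₁ (avoids blocked) ∷ proj₂ (avoids blocked) ∷ []
    x# : x ≢ c × x ≢ c′
    x# = avoids x!

  pattern 0th = here refl
  pattern 1st = there 0th
  pattern 2nd = there 1st
  pattern 3rd = there 2nd
  pattern 4th = there 3rd

  thirds-≢ : Line x a b → Line y a c → x ≢ y → b ≢ c
  thirds-≢ l l′ x≢y refl = x≢y (third (rotate l) (rotate l′))

  -- Otherwise the third spoke, at z, has to avoid only the four points x, w, r and r′.
  covered : Line x y z → 4 ≤ degree G y → 5 ≤ degree G z →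
            Line x a w → a ≢ y → a ≢ z → ∃ λ t → Line z a t
  covered {x} {y} {z} {a} {w} l dy dz la a≢y a≢z with line? (a≢z ∘ sym)
  ... | yes found = found
  ... | no  ¬found
    with w≢y , w≢z ← off-base l la a≢y a≢z
    with r , r′ , lr , x≢r ∷ a≢r ∷ w≢r ∷ [] , x≢r′ ∷ a≢r′ ∷ w≢r′ ∷ [] ←
           line-avoiding y (x ∷ a ∷ w ∷ []) (≢₁₂ l ∷ a≢y ∷ w≢y ∷ []) dy
    = ⊥-elim (no-crown-avoiding l la lr a≢y a≢z (x≢r ∘ sym) r≢z
        ((a≢r ∷ a≢r′ ∷ []) ∷ (w≢r ∷ w≢r′ ∷ []) ∷ [])
        (x ∷ w ∷ r ∷ r′ ∷ []) (≢₁₃ l ∷ w≢z ∷ r≢z ∷ r′≢z ∷ []) dz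
        (inj₁ 0th ∷ inj₂ (λ t lt → contradiction (t , lt) ¬found) ∷ inj₁ 1st ∷ inj₁ 2nd ∷ inj₁ 3rd ∷ []))
    where
    r≢z : r ≢ z
    r≢z refl = x≢r′ (third (rotate l) lr)
    r′≢z : r′ ≢ z
    r′≢z refl = x≢r (third (rotate l) (swap₂₃ lr))

  -- A line `y c t` exists by `covered`. If `t` were not `w`, then `x a w` and `y c t` would be
  -- disjoint spokes. The third one would have to avoid only `x`, `a`, `w` and `t`, because the line
  -- through `z` and `c` contains `a`.
  block : Line x y z → 4 ≤ degree G x → 5 ≤ degree G y → 5 ≤ degree G z →
          Line x a w → a ≢ y → a ≢ z → Line z a c → Line y c w
  block {x} {y} {z} {a} {w} {c} l dx dy dz la a≢y a≢z lc
    with w≢y , w≢z ← off-base l la a≢y a≢z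
    with c≢x , c≢y ← off-base (rotate² l) lc (≢₁₂ la ∘ sym) a≢y
    with t , lt ← covered (rotate² l) dx dy (swap₂₃ lc) c≢x c≢y
    with t ≟ w
  ... | yes refl = lt
  ... | no  t≢w  = ⊥-elim (no-crown-avoiding l la lt a≢y a≢z c≢x (≢₁₃ lc ∘ sym)
        ((≢₂₃ lc ∷ a≢t ∷ []) ∷ (w≢c ∷ (t≢w ∘ sym) ∷ []) ∷ [])
        (x ∷ a ∷ w ∷ t ∷ []) (≢₁₃ l ∷ a≢z ∷ w≢z ∷ t≢z ∷ []) dz
        (inj₁ 0th ∷ inj₁ 1st ∷ inj₁ 2nd ∷
         inj₂ (λ u lu → subst (List._∈ x ∷ a ∷ w ∷ t ∷ []) (third (swap₂₃ lc) lu) 1st) ∷ inj₁ 3rd ∷ []))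
    where
    a≢t : a ≢ t
    a≢t = thirds-≢ (swap₂₃ lc) lt (≢₂₃ l ∘ sym)
    w≢c : w ≢ c
    w≢c = thirds-≢ la lc (≢₁₃ l)
    t≢z : t ≢ z
    t≢z refl = c≢x (third (swap₂₃ lt) (rotate l))

  -- A further edge {a , p , q} at a, to be refuted in degree≤3.
  module Extra (l : Line x y z) (dx : 4 ≤ degree G x) (dy : 5 ≤ degree G y) (dz : 5 ≤ degree G z)
               (la : Line x a w) (a≢y : a ≢ y) (a≢z : a ≢ z) (lb : Line y a b) (lc : Line z a c)
               (lh : Line a p q)
               (p≢x : p ≢ x) (p≢y : p ≢ y) (p≢z : p ≢ z) (q≢x : q ≢ x) (q≢y : q ≢ y) (q≢z : q ≢ z) where

    -- This is `block` with the roles of `y` and `z` exchanged.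
    lz : Line z b w
    lz = block (swap₂₃ l) dx dz dy la a≢z a≢y lb

    apart-zw : All (λ u → All (u ≢_) (z ∷ w ∷ [])) (p ∷ q ∷ [])
    apart-zw = (p≢z ∷ p≢w ∷ []) ∷ (q≢z ∷ q≢w ∷ []) ∷ []
      where
      p≢w : p ≢ w
      p≢w refl = q≢x (third lh (rotate la))
      q≢w : q ≢ w
      q≢w refl = p≢x (third (swap₂₃ lh) (rotate la))

    p≢b : p ≢ b
    p≢b refl = q≢y (third lh (rotate lb))

    q≢b : q ≢ b
    q≢b refl = p≢y (third (swap₂₃ lh) (rotate lb))

    -- Otherwise the crown has base {a , b , y} and spokes {a , p , q}, {b , z , w}.
    p-covered : ∃ λ t → Line y p t
    p-covered with line? (p≢y ∘ sym)
    ... | yes found = found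
    ... | no ¬found = ⊥-elim (no-crown-avoiding (rotate lb) lh (swap₁₂ lz) p≢b p≢y (a≢z ∘ sym) (≢₂₃ l ∘ sym) apart-zw
          (a ∷ z ∷ w ∷ q ∷ []) (a≢y ∷ (≢₂₃ l ∘ sym) ∷ proj₁ (off-base l la a≢y a≢z) ∷ q≢y ∷ []) dy
          (inj₁ 0th ∷ inj₂ (λ t lt → contradiction (t , lt) ¬found) ∷ inj₁ 3rd ∷ inj₁ 1st ∷ inj₁ 2nd ∷ []))

    -- The crown has base {a , w , x} and spokes {a , p , q}, {w , z , b}, {x , m , m′}.
    extra-hit : ∀ {m m′} → Line x m m′ → m ≢ y → m ≢ z → m ≢ a → m′ ≢ a → m ≢ b → m′ ≢ b →
                ¬ All (λ u → All (u ≢_) (m ∷ m′ ∷ [])) (p ∷ q ∷ [])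
    extra-hit {m} {m′} lm m≢y m≢z m≢a m′≢a m≢b m′≢b pq#m =
      no-crown-at (rotate la) lh (rotate² lz) lm (All.head (All.tail (All.head apart-zw))) p≢x
        (a≢z ∘ sym) (≢₁₃ l ∘ sym) m≢a m≢w
        ((p≢z ∷ p≢b ∷ []) ∷ (q≢z ∷ q≢b ∷ []) ∷ []) pq#m
        (((m≢z ∘ sym) ∷ (m′≢z ∘ sym) ∷ []) ∷ ((m≢b ∘ sym) ∷ (m′≢b ∘ sym) ∷ []) ∷ [])
      where
      m′≢z : m′ ≢ z
      m′≢z = proj₂ (off-base l lm m≢y m≢z)
      m≢w : m ≢ w
      m≢w refl = m′≢a (third lm (swap₂₃ la))

    -- The crown has base {a , p , q} and spokes {a , y , b}, {p , z , p″}, {q , x , s}.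
    thirds-≡ : Line x q s → s ≢ y → s ≢ z → s ≢ b → Line z p p″ → s ≡ p″
    thirds-≡ {s} {p″} ls s≢y s≢z s≢b lp with s ≟ p″
    ... | yes eq   = eq
    ... | no  s≢p″ = ⊥-elim (no-crown-at lh (swap₁₂ lb) (swap₁₂ lp) (swap₁₂ ls)
            (p≢y ∘ sym) (q≢y ∘ sym) (a≢z ∘ sym) (q≢z ∘ sym) (≢₁₂ la) (p≢x ∘ sym)
            ((≢₂₃ l ∷ y≢p″ ∷ []) ∷ (b≢z ∷ b≢p″ ∷ []) ∷ [])
            (((≢₁₂ l ∘ sym) ∷ (s≢y ∘ sym) ∷ []) ∷ (b≢x ∷ (s≢b ∘ sym) ∷ []) ∷ [])
            (((≢₁₃ l ∘ sym) ∷ (s≢z ∘ sym) ∷ []) ∷ (p″≢x ∷ (s≢p″ ∘ sym) ∷ []) ∷ []))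
      where
      b≢xz : b ≢ x × b ≢ z
      b≢xz = off-base (swap₁₂ l) lb (≢₁₂ la ∘ sym) a≢z
      b≢x = proj₁ b≢xz
      b≢z = proj₂ b≢xz
      y≢p″ : y ≢ p″
      y≢p″ refl = p≢x (third (swap₂₃ lp) (swap₂₃ (rotate² l)))
      p″≢x : p″ ≢ x
      p″≢x refl = p≢y (third (swap₂₃ lp) (rotate² l))
      b≢p″ : b ≢ p″
      b≢p″ refl = All.head (All.tail (All.head apart-zw)) (third (swap₂₃ lp) lz)

  -- By `p-covered`, used also with `y` and `z` exchanged, there are lines from `y` and from `z`
  -- through `p`. By `thirds-≡` both have third point `s`, so they share `p` and `s` and coincide,
  -- which forces `y` and `z` to be equal.
  no-extra : Line x y z → 4 ≤ degree G x → 5 ≤ degree G y → 5 ≤ degree G z →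
    Line x a w → a ≢ y → a ≢ z → Line y a b → Line z a c →
    Line a p q → p ≢ x → p ≢ y → p ≢ z → q ≢ x → q ≢ y → q ≢ z →
    Line x q s → q ≢ b → s ≢ y → s ≢ z → s ≢ b → ⊥
  no-extra {b = b} {c = c} {q = q} {s = s} l dx dy dz la a≢y a≢z lb lc lh p≢x p≢y p≢z q≢x q≢y q≢z
           ls q≢b s≢y s≢z s≢b
    with _ , lp′ ← Extra.p-covered l dx dy dz la a≢y a≢z lb lc lh p≢x p≢y p≢z q≢x q≢y q≢z
       | _ , lp″ ← Extra.p-covered (swap₂₃ l) dx dz dy la a≢z a≢y lc lb lh p≢x p≢z p≢y q≢x q≢z q≢y
    = thirds-≢ lp′ lp″ (≢₂₃ l) (trans
        (sym (Extra.thirds-≡ (swap₂₃ l) dx dz dy la a≢z a≢y lc lb lh p≢x p≢z p≢y q≢x q≢z q≢y ls s≢z s≢y s≢c lp′))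
        (Extra.thirds-≡ l dx dy dz la a≢y a≢z lb lc lh p≢x p≢y p≢z q≢x q≢y q≢z ls s≢y s≢z s≢b lp″))
    where
    -- If `s` were `c`, then `block` for the lines `x c q` and `z c a` would give a line `y a q`, so
    -- `q` would be `b`.
    s≢c : s ≢ c
    s≢c refl = q≢b (sym (third lb (block l dx dy dz (swap₂₃ ls) s≢y s≢z (swap₂₃ lc))))

  -- A fourth edge at `a` yields a line `a p q` missing `x`, `y` and `z`. As `x` has degree at least
  -- 4, it has a line `x m m′` avoiding `y`, `a` and `b`. If this line misses `p` and `q`,
  -- `extra-hit` applies; otherwise `no-extra` does, with `p` and `q` exchanged if it is `p` that
  -- lies on it.
  degree≤3 : Line x y z → 4 ≤ degree G x → 5 ≤ degree G y → 5 ≤ degree G z →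
             Line x a w → a ≢ y → a ≢ z → degree G a ≤ 3
  degree≤3 {x} {y} {z} {a} {w} l dx dy dz la a≢y a≢z = ≮⇒≥ λ 4≤ →
    let b , lb = covered (swap₂₃ l) (≤-trans (n≤1+n 4) dz) dy la a≢z a≢y
        c , lc = covered l (≤-trans (n≤1+n 4) dy) dz la a≢y a≢z
        p , q , lh , xyz≢p , xyz≢q =
          line-avoiding a (x ∷ y ∷ z ∷ []) (≢₁₂ la ∷ (a≢y ∘ sym) ∷ (a≢z ∘ sym) ∷ []) 4≤
        b≢x , _ = off-base (swap₁₂ l) lb (≢₁₂ la ∘ sym) a≢z
        m , m′ , lm , yab≢m , yab≢m′ =
          line-avoiding x (y ∷ a ∷ b ∷ []) ((≢₁₂ l ∘ sym) ∷ (≢₁₂ la ∘ sym) ∷ b≢x ∷ []) dx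
    in contra lb lc lh xyz≢p xyz≢q lm yab≢m yab≢m′
    where
    contra : ∀ {m m′} → Line y a b → Line z a c → Line a p q →
             All (_≢ p) (x ∷ y ∷ z ∷ []) → All (_≢ q) (x ∷ y ∷ z ∷ []) →
             Line x m m′ → All (_≢ m) (y ∷ a ∷ b ∷ []) → All (_≢ m′) (y ∷ a ∷ b ∷ []) → ⊥
    contra {b} {c} {p} {q} {m} {m′} lb lc lh (x≢p ∷ y≢p ∷ z≢p ∷ []) (x≢q ∷ y≢q ∷ z≢q ∷ [])
           lm (y≢m ∷ a≢m ∷ b≢m ∷ []) (y≢m′ ∷ a≢m′ ∷ b≢m′ ∷ []) = hit (p ≟ m) (p ≟ m′) (q ≟ m) (q ≟ m′)
      where
      m≢z : m ≢ z
      m≢z refl = y≢m′ (third (swap₂₃ l) lm)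
      m′≢z : m′ ≢ z
      m′≢z refl = y≢m (third (swap₂₃ l) (swap₂₃ lm))
      through-q : Line x q s → b ≢ q → y ≢ s → s ≢ z → b ≢ s → ⊥
      through-q ls b≢q y≢s s≢z b≢s = no-extra l dx dy dz la a≢y a≢z lb lc lh
        (x≢p ∘ sym) (y≢p ∘ sym) (z≢p ∘ sym) (x≢q ∘ sym) (y≢q ∘ sym) (z≢q ∘ sym)
        ls (b≢q ∘ sym) (y≢s ∘ sym) s≢z (b≢s ∘ sym)
      through-p : Line x p s → b ≢ p → y ≢ s → s ≢ z → b ≢ s → ⊥
      through-p ls b≢p y≢s s≢z b≢s = no-extra l dx dy dz la a≢y a≢z lb lc (swap₂₃ lh)
        (x≢q ∘ sym) (y≢q ∘ sym) (z≢q ∘ sym) (x≢p ∘ sym) (y≢p ∘ sym) (z≢p ∘ sym)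
        ls (b≢p ∘ sym) (y≢s ∘ sym) s≢z (b≢s ∘ sym)
      hit : Dec (p ≡ m) → Dec (p ≡ m′) → Dec (q ≡ m) → Dec (q ≡ m′) → ⊥
      hit (yes refl) _ _ _ = through-p lm b≢m y≢m′ m′≢z b≢m′
      hit _ (yes refl) _ _ = through-p (swap₂₃ lm) b≢m′ y≢m m≢z b≢m
      hit _ _ (yes refl) _ = through-q lm b≢m y≢m′ m′≢z b≢m′
      hit _ _ _ (yes refl) = through-q (swap₂₃ lm) b≢m′ y≢m m≢z b≢m
      hit (no p≢m) (no p≢m′) (no q≢m) (no q≢m′) =
        Extra.extra-hit l dx dy dz la a≢y a≢z lb lc lh
          (x≢p ∘ sym) (y≢p ∘ sym) (z≢p ∘ sym) (x≢q ∘ sym) (y≢q ∘ sym) (z≢q ∘ sym)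
          lm (y≢m ∘ sym) m≢z (a≢m ∘ sym) (a≢m′ ∘ sym) (b≢m ∘ sym) (b≢m′ ∘ sym)
          ((p≢m ∷ p≢m′ ∷ []) ∷ (q≢m ∷ q≢m′ ∷ []) ∷ [])

-- Unequal sharing for r = 3

length-filter-skip : ∀ {P : A → Set} (P? : Decidable P) {x xs} → x List.∈ xs → ¬ P x →
                     length (filter P? xs) < length xs
length-filter-skip P? x∈ ¬px = filter-notAll P? _ (List.lose x∈ ¬px)

length-filter-skip₂ : ∀ {P : A → Set} (P? : Decidable P) {x y xs} → x List.∈ xs → y List.∈ xs → x ≢ y →
                      ¬ P x → ¬ P y → 2 + length (filter P? xs) ≤ length xs
length-filter-skip₂ P? (here refl) (here refl) x≢y _ _ = contradiction refl x≢y
length-filter-skip₂ P? {xs = z ∷ zs} (here refl) (there y∈) _ ¬px ¬py with P? z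
... | yes px = contradiction px ¬px
... | no _   = s≤s (length-filter-skip P? y∈ ¬py)
length-filter-skip₂ P? {xs = z ∷ zs} (there x∈) (here refl) _ ¬px ¬py with P? z
... | yes py = contradiction py ¬py
... | no _   = s≤s (length-filter-skip P? x∈ ¬px)
length-filter-skip₂ P? {xs = z ∷ zs} (there x∈) (there y∈) x≢y ¬px ¬py with P? z
... | yes _ = s≤s (length-filter-skip₂ P? x∈ y∈ x≢y ¬px ¬py)
... | no _  = m≤n⇒m≤1+n (length-filter-skip₂ P? x∈ y∈ x≢y ¬px ¬py)

-- The share of an edge at a vertex of degree d; the flag matters only for degree 5, where the 36 units
-- are split as 8 + 8 + 8 + 6 + 6.
share : ℕ → Bool → ℕ
share 0 _     = 36
share 1 _     = 36
share 2 _     = 12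
share 3 _     = 12
share 4 _     = 9
share _ true  = 8
share _ false = 6

share≥6 : ∀ k h → 6 ≤ share k h
share≥6 0 _ = m≤m+n 6 30
share≥6 1 _ = m≤m+n 6 30
share≥6 2 _ = m≤m+n 6 6
share≥6 3 _ = m≤m+n 6 6
share≥6 4 _ = m≤m+n 6 3
share≥6 (suc (suc (suc (suc (suc _))))) true  = m≤m+n 6 2
share≥6 (suc (suc (suc (suc (suc _))))) false = m≤m+n 6 0

share≥8 : ∀ k → 8 ≤ share k true
share≥8 0 = m≤m+n 8 28
share≥8 1 = m≤m+n 8 28
share≥8 2 = m≤m+n 8 4
share≥8 3 = m≤m+n 8 4
share≥8 4 = m≤m+n 8 1
share≥8 (suc (suc (suc (suc (suc _))))) = m≤m+n 8 0

share≥9 : ∀ {k} → k ≤ 4 → ∀ h → 9 ≤ share k h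
share≥9 {0} _ _ = m≤m+n 9 27
share≥9 {1} _ _ = m≤m+n 9 27
share≥9 {2} _ _ = m≤m+n 9 3
share≥9 {3} _ _ = m≤m+n 9 3
share≥9 {4} _ _ = m≤m+n 9 0
share≥9 {suc (suc (suc (suc (suc _))))} (s≤s (s≤s (s≤s (s≤s ())))) _

share≥12 : ∀ {k} → k ≤ 3 → ∀ h → 12 ≤ share k h
share≥12 {0} _ _ = m≤m+n 12 24
share≥12 {1} _ _ = m≤m+n 12 24
share≥12 {2} _ _ = m≤m+n 12 0
share≥12 {3} _ _ = m≤m+n 12 0
share≥12 {suc (suc (suc (suc _)))} (s≤s (s≤s (s≤s ()))) _

share≥36 : ∀ {k} → k ≤ 1 → ∀ h → 36 ≤ share k h
share≥36 {0} _ _ = m≤m+n 36 0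
share≥36 {1} _ _ = m≤m+n 36 0
share≥36 {suc (suc _)} (s≤s ()) _

-- The three cases give 12 + 6 + 6, 9 + 9 + 6 and 8 + 8 + 8. In the last one the degrees are at
-- least (4,5,5), so all three flags are set.
shares≥24 : ∀ {i j k} {h₁ h₂ h₃} → i ≤ j → j ≤ k →
  (4 ≤ j → 5 ≤ k → h₁ ≡ true) → (4 ≤ i → 5 ≤ k → h₂ ≡ true) → (4 ≤ i → 5 ≤ j → h₃ ≡ true) →
  24 ≤ share i h₁ + (share j h₂ + (share k h₃ + 0))
shares≥24 {i} {j} {k} {h₁} {h₂} {h₃} i≤j j≤k heavy₁ heavy₂ heavy₃ with i ≤? 3
... | yes i≤3 = +-mono-≤ (share≥12 i≤3 h₁) (+-mono-≤ (share≥6 j h₂) (+-mono-≤ (share≥6 k h₃) z≤n))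
... | no  i≰3 with j ≤? 4
...   | yes j≤4 = +-mono-≤ (share≥9 (≤-trans i≤j j≤4) h₁) (+-mono-≤ (share≥9 j≤4 h₂) (+-mono-≤ (share≥6 k h₃) z≤n))
...   | no  j≰4
  rewrite heavy₁ (≤-trans (≰⇒> i≰3) i≤j) (≤-trans (≰⇒> j≰4) j≤k)
        | heavy₂ (≰⇒> i≰3) (≤-trans (≰⇒> j≰4) j≤k)
        | heavy₃ (≰⇒> i≰3) (≰⇒> j≰4)
  = +-mono-≤ (share≥8 i) (+-mono-≤ (share≥8 j) (+-mono-≤ (share≥8 k) z≤n))

sum-share-5 : ∀ {P : A → Set} (P? : Decidable P) xs →
  sum (map (λ x → share 5 (does (P? x))) xs) ≡ length xs * 6 + length (filter P? xs) * 2
sum-share-5 P? []       = refl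
sum-share-5 P? (x ∷ xs) with does (P? x)
... | true  = trans (cong (λ k → 8 + k) (sum-share-5 P? xs)) (lem (length xs * 6) (length (filter P? xs) * 2))
  where
  lem : ∀ a b → 8 + (a + b) ≡ 6 + a + (2 + b)
  lem = solve-∀
... | false = cong (λ k → 6 + k) (sum-share-5 P? xs)

-- The length is a separate variable `k`, so that matching on it lets `share k` compute. For `k`
-- equal to 5 the total is at most 5 · 6 + 3 · 2 = 36.
sum-share : ∀ {P : A → Set} (P? : Decidable P) xs {k} → length xs ≡ k → k ≤ 5 →
  (k ≡ 5 → length (filter P? xs) ≤ 3) → sum (map (λ x → share k (does (P? x))) xs) ≤ 36
sum-share P? xs {k} ∣xs∣ k≤5 few = cases k ∣xs∣ k≤5 few
  where
  const : ∀ {c} k {f} → length xs ≡ k → (∀ x → f x ≤ c) → k * c ≤ 36 → sum (map f xs) ≤ 36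
  const {c} k eq f≤c kc≤ = ≤-trans (sum-≤-const (All.universal f≤c xs)) (≤-trans (≤-reflexive (cong (_* c) eq)) kc≤)
  cases : ∀ k → length xs ≡ k → k ≤ 5 → (k ≡ 5 → length (filter P? xs) ≤ 3) →
          sum (map (λ x → share k (does (P? x))) xs) ≤ 36
  cases 0 eq _ _ = const 0 eq (λ _ → ≤-refl) z≤n
  cases 1 eq _ _ = const 1 eq (λ _ → ≤-refl) ≤-refl
  cases 2 eq _ _ = const 2 eq (λ _ → ≤-refl) (m≤m+n 24 12)
  cases 3 eq _ _ = const 3 eq (λ _ → ≤-refl) ≤-refl
  cases 4 eq _ _ = const 4 eq (λ _ → ≤-refl) ≤-refl
  cases 5 eq _ few = begin
    sum (map (λ x → share 5 (does (P? x))) xs)    ≡⟨ sum-share-5 P? xs ⟩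
    length xs * 6 + length (filter P? xs) * 2     ≤⟨ +-mono-≤ (≤-reflexive (cong (_* 6) eq)) (*-monoˡ-≤ 2 (few refl)) ⟩
    36                                            ∎
    where open ≤-Reasoning
  cases (suc (suc (suc (suc (suc (suc _)))))) _ (s≤s (s≤s (s≤s (s≤s (s≤s ()))))) _

module _ (G : RGraph 3 n) (linear : Linear G) (crown-free : CrownFree G) where

  open Triples G linear crown-free

  -- For `v` of degree 5, among edges with all degrees at most 5, these are the edges with degrees
  -- (4,5,5) or (5,5,5). At smaller degrees of `v` the flag does not affect `share`.
  Heavy : Fin n → Subset n → Set
  Heavy v e = ∃ λ x → ∃ λ z → x ∈ e × z ∈ e × x ≢ v × z ≢ v × x ≢ z × 4 ≤ degree G x × 5 ≤ degree G z

  heavy? : ∀ v → Decidable (Heavy v)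
  heavy? v e = any? λ x → any? λ z → x ∈? e ×-dec z ∈? e ×-dec ¬? (x ≟ v) ×-dec ¬? (z ≟ v) ×-dec ¬? (x ≟ z)
                 ×-dec 4 ≤? degree G x ×-dec 5 ≤? degree G z

  ¬heavy : ∀ {y a b} (l : Line y a b) → degree G a ≤ 3 → ¬ Heavy y (Line.edge l)
  ¬heavy l da (x , z , x∈ , z∈ , x≢y , z≢y , x≢z , 4≤x , 5≤z) with from (Line.enum l) x∈ | from (Line.enum l) z∈
  ... | 0th | _   = x≢y refl
  ... | 1st | _   = <⇒≱ 4≤x da
  ... | 2nd | 0th = z≢y refl
  ... | 2nd | 1st = <⇒≱ 5≤z (≤-trans da (n≤1+n 3))
  ... | 2nd | 2nd = x≢z refl

  -- Given one heavy edge `x v z`, take another line `x a w` at `x`. By `degree≤3` both `a` and `w`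
  -- have degree at most 3, so the lines joining them to `v`, which exist by `covered`, are two of
  -- the five edges that are not heavy.
  heavy-few : ∀ {v} → degree G v ≡ 5 → length (filter (heavy? v) (filter (v ∈?_) (edges G))) ≤ 3
  heavy-few {v} dv with Any.any? (heavy? v) (filter (v ∈?_) (edges G))
  ... | no  none = ≤-trans (≤-reflexive (cong length (filter-none (heavy? v) (Allₚ.¬Any⇒All¬ _ none)))) z≤n
  ... | yes some
    with e , e∈ , x , z , x∈e , z∈e , x≢v , z≢v , x≢z , 4≤x , 5≤z ← List.find some
    with e∈E , v∈e ← ∈-filter⁻ (v ∈?_) e∈ = ≤-pred (≤-pred (begin
      2 + length (filter (heavy? v) (filter (v ∈?_) (edges G)))
        ≤⟨ length-filter-skip₂ (heavy? v) (at la′) (at lw′) edges-differ (¬heavy la′ a≤3) (¬heavy lw′ w≤3) ⟩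
      degree G v
        ≡⟨ dv ⟩
      5 ∎))
    where
    open ≤-Reasoning
    5≤v : 5 ≤ degree G v
    5≤v = ≤-reflexive (sym dv)
    l : Line x v z
    l = line-of e∈E x∈e v∈e z∈e x≢v (z≢v ∘ sym) x≢z
    at : ∀ {a b} (l : Line v a b) → Line.edge l List.∈ filter (v ∈?_) (edges G)
    at l = ∈-filter⁺ (v ∈?_) (Line.edge∈ l) (to (Line.enum l) 0th)
    x-line = line-avoiding x (v ∷ z ∷ []) ((x≢v ∘ sym) ∷ (x≢z ∘ sym) ∷ []) (≤-trans (n≤1+n 3) 4≤x)
    a = proj₁ x-line
    w = proj₁ (proj₂ x-line)
    la : Line x a w
    la = proj₁ (proj₂ (proj₂ x-line))
    vz≢a = proj₁ (proj₂ (proj₂ (proj₂ x-line)))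
    vz≢w = proj₂ (proj₂ (proj₂ (proj₂ x-line)))
    a≢v = All.head vz≢a ∘ sym
    a≢z = All.head (All.tail vz≢a) ∘ sym
    w≢v = All.head vz≢w ∘ sym
    w≢z = All.head (All.tail vz≢w) ∘ sym
    a≤3 : degree G a ≤ 3
    a≤3 = degree≤3 l 4≤x 5≤v 5≤z la a≢v a≢z
    w≤3 : degree G w ≤ 3
    w≤3 = degree≤3 l 4≤x 5≤v 5≤z (swap₂₃ la) w≢v w≢z
    la′ : Line v a (proj₁ (covered (swap₂₃ l) (≤-trans (n≤1+n 4) 5≤z) 5≤v la a≢z a≢v))
    la′ = proj₂ (covered (swap₂₃ l) (≤-trans (n≤1+n 4) 5≤z) 5≤v la a≢z a≢v)
    lw′ : Line v w (proj₁ (covered (swap₂₃ l) (≤-trans (n≤1+n 4) 5≤z) 5≤v (swap₂₃ la) w≢z w≢v))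
    lw′ = proj₂ (covered (swap₂₃ l) (≤-trans (n≤1+n 4) 5≤z) 5≤v (swap₂₃ la) w≢z w≢v)
    -- A single edge through `v`, `a` and `w` would be the line `x a w`, and `x` would be `v`.
    edges-differ : Line.edge la′ ≢ Line.edge lw′
    edges-differ eq = x≢v (third (rotate la) (line-of (Line.edge∈ la′) (to (Line.enum la′) 1st)
      (subst (w ∈_) (sym eq) (to (Line.enum lw′) 1st)) (to (Line.enum la′) 0th) (≢₂₃ la) w≢v a≢v))

  weight : Fin n → Subset n → ℕ
  weight v e = share (degree G v) (does (heavy? v e))

  -- By the poor prefix, the edge has one vertex of degree at most 1, giving 36, or two of degree at
  -- most 3, giving 12 each, or all three of degree at most 5, where `shares≥24` applies.
  edge-share : ∀ {e us} → e List.∈ edges G → us Enumerates e → ByDegree G us →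
               24 ≤ sum (map (λ v → capped G 6 weight v e) us)
  edge-share {e} {us} e∈E en sorted =
    shares us (trans (length-enumeration en) (All.lookup (uniform G) e∈E)) en sorted
      (poor-prefix₀ G linear (s≤s (s≤s z≤n)) crown-free e∈E en sorted)
    where
    c : Fin n → ℕ
    c v = capped G 6 weight v e
    c≡ : ∀ {v} → degree G v ≤ 5 → c v ≡ weight v e
    c≡ v≤5 = capped-low G weight (s≤s v≤5)
    heavy : ∀ {v x z} → x ∈ e → z ∈ e → x ≢ v → z ≢ v → x ≢ z →
            4 ≤ degree G x → 5 ≤ degree G z → does (heavy? v e) ≡ true
    heavy {v} {x} {z} x∈e z∈e x≢v z≢v x≢z 4≤x 5≤z =
      dec-true (heavy? v e) (x , z , x∈e , z∈e , x≢v , z≢v , x≢z , 4≤x , 5≤z)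
    shares : ∀ us → length us ≡ 3 → us Enumerates e → ByDegree G us →
      (∃ λ i → ∃₂ λ xs ys → us ≡ xs ++ ys × length xs ≡ suc i × suc i ≤ 3 × All (Low G (i * 2 + 1)) xs) →
      24 ≤ sum (map c us)
    shares (u ∷ v ∷ w ∷ []) refl _ _ (0 , _ ∷ [] , _ , refl , refl , _ , u≤1 ∷ []) = begin
      24                         ≤⟨ m≤m+n 24 12 ⟩
      36                         ≤⟨ share≥36 u≤1 _ ⟩
      weight u e                 ≡⟨ c≡ (≤-trans u≤1 (m≤m+n 1 4)) ⟨
      c u                        ≤⟨ m≤m+n (c u) _ ⟩
      sum (map c (u ∷ v ∷ w ∷ [])) ∎
      where open ≤-Reasoning
    shares (u ∷ v ∷ w ∷ []) refl _ _ (1 , _ ∷ _ ∷ [] , _ , refl , refl , _ , u≤3 ∷ v≤3 ∷ []) = begin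
      12 + (12 + 0)                     ≤⟨ +-mono-≤ (share≥12 u≤3 _) (+-mono-≤ (share≥12 v≤3 _) z≤n) ⟩
      weight u e + (weight v e + c′)    ≡⟨ cong₂ (λ i j → i + (j + c′)) (c≡ (≤-trans u≤3 (m≤m+n 3 2)))
                                                                    (c≡ (≤-trans v≤3 (m≤m+n 3 2))) ⟨
      sum (map c (u ∷ v ∷ w ∷ []))      ∎
      where
      open ≤-Reasoning
      c′ : ℕ
      c′ = c w + 0
    shares (u ∷ v ∷ w ∷ []) refl en ((u≤v ∷ _ ∷ []) ∷ (v≤w ∷ []) ∷ _)
           (2 , _ ∷ _ ∷ _ ∷ [] , _ , refl , refl , _ , u≤5 ∷ v≤5 ∷ w≤5 ∷ [])
      with (u≢v ∷ u≢w ∷ []) ∷ (v≢w ∷ []) ∷ _ ← distinct en = begin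
      24                                            ≤⟨ shares≥24 u≤v v≤w
                                                         (heavy (to en 1st) (to en 2nd) (u≢v ∘ sym) (u≢w ∘ sym) v≢w)
                                                         (heavy (to en 0th) (to en 2nd) u≢v (v≢w ∘ sym) u≢w)
                                                         (heavy (to en 0th) (to en 1st) u≢w v≢w u≢v) ⟩
      weight u e + (weight v e + (weight w e + 0))  ≡⟨ cong₂ _+_ (c≡ u≤5) (cong₂ _+_ (c≡ v≤5) (cong (_+ 0) (c≡ w≤5))) ⟨
      sum (map c (u ∷ v ∷ w ∷ []))                  ∎
      where open ≤-Reasoning
    shares _ _ _ _ (suc (suc (suc _)) , _ , _ , _ , _ , s≤s (s≤s (s≤s ())) , _)

  bound-r≡3 : 2 * ∣E G ∣ ≤ 3 * (n ∸ #degree≥ 6 G)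
  -- The factor 12 scales the coefficients 2 and 3 to the 24 units due to an edge and the 36 units
  -- held by a vertex.
  bound-r≡3 = *-cancelˡ-≤ 12 (begin
    12 * (2 * ∣E G ∣)                ≡⟨ *-assoc 12 2 ∣E G ∣ ⟨
    24 * ∣E G ∣                      ≤⟨ double-counting G 6 weight
                                          (λ v v<6 → sum-share (heavy? v) (filter (v ∈?_) (edges G)) refl (≤-pred v<6) heavy-few)
                                          edge-share ⟩
    36 * (n ∸ #degree≥ 6 G)          ≡⟨ *-assoc 12 3 (n ∸ #degree≥ 6 G) ⟩
    12 * (3 * (n ∸ #degree≥ 6 G))    ∎)
    where open ≤-Reasoning

-- Passage to rational numbers

-- Since `ℚ./` reduces its fraction, the comparison is made between unnormalised fractions, where it
-- is cross multiplication.
k/1≤m/d : ∀ k {m d} → suc d * k ≤ m → (+ k) ℚ./ 1 ℚ.≤ (+ m) ℚ./ suc d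
k/1≤m/d k {m} {d} dk≤m = ℚ.toℚᵘ-cancel-≤ (begin
  ℚ.toℚᵘ ((+ k) ℚ./ 1)      ≃⟨ ℚ.toℚᵘ-fromℚᵘ (ℚᵘ.mkℚᵘ (+ k) 0) ⟩
  ℚᵘ.mkℚᵘ (+ k) 0           ≤⟨ ℚᵘ.*≤* (subst₂ ℤ._≤_ (ℤ.pos-* k (suc d)) (ℤ.pos-* m 1)
                                 (+≤+ (subst₂ _≤_ (*-comm (suc d) k) (sym (*-identityʳ m)) dk≤m))) ⟩
  ℚᵘ.mkℚᵘ (+ m) d           ≃⟨ ℚ.toℚᵘ-fromℚᵘ (ℚᵘ.mkℚᵘ (+ m) d) ⟨
  ℚ.toℚᵘ ((+ m) ℚ./ suc d)  ∎)
  where open ℚᵘ.≤-Reasoning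

theorem2p1 : ∀ (r n : ℕ) (r≥3 : 3 ≤ r) (G : RGraph r n) → Linear G → CrownFree G → C*Free G →
    let s = #degree≥ ((r ∸ 1) ^ 2 + 2) G
        instance _ = r∸1-nonZero r≥3
    in (+ ∣E G ∣) ℚ./ 1 ℚ.≤ (+ (r * (r ∸ 2) * (n ∸ s))) ℚ./ (r ∸ 1)
theorem2p1 3 n (s≤s (s≤s (s≤s z≤n))) G linear crown-free _ = k/1≤m/d ∣E G ∣ (bound-r≡3 G linear crown-free)
theorem2p1 (suc (suc (suc (suc m)))) n (s≤s (s≤s (s≤s z≤n))) G linear crown-free _ =
  k/1≤m/d ∣E G ∣ (bound-r≥4 (s≤s (s≤s z≤n)) G linear crown-free)
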